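{- Let $m\geqslant 2$ be an integer and let $G$ be a finite group with $|G|\geqslant 2$. Then the diagonal graph $\Gamma_D(G,m)$ is distance-regular if and only if either $m=2$ or $|G|=2$.
   Context: Diagonal graph: for a group $G$ and an integer $m\geqslant 1$, let $\Omega=G^m$. For $1\leqslant i\leqslant m$, let $Q_i$ be the partition of $\Omega$ in which $(g_1,\ldots,g_m)$ and $(h_1,\ldots,h_m)$ are in the same part if and only if $g_j=h_j$ for all $j\neq i$. Let $Q_0$ be the partition in which $(g_1,\ldots,g_m)$ and $(h_1,\ldots,h_m)$ are in the same part if and only if there is $x\in G$ with $h_i=xg_i$ for all $i$. The diagonal graph $\Gamma_D(G,m)$ is the simple graph with vertex set $\Omega$ in which two distinct vertices are adjacent if and only if they lie in the same part of at least one of $Q_0,Q_1,\ldots,Q_m$. A finite connected graph $\Gamma$ is distance-regular if for every integer $d\geqslant 0$ and all vertices $u,v$ at distance $d$, the numbers of neighbours of $v$ at distance $d-1$, $d$ and $d+1$ from $u$ depend only on $d$ (and not on the choice of $u,v$). Strongly regular connected graphs and complete graphs are included as distance-regular. -}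

module Defs where

open import Algebra.Bundles using (Group)
import Algebra.Properties.Group as GroupProperties
open import Data.Fin.Base using (Fin)
open import Data.Nat.Base using (ℕ; suc; _≤_)
open import Data.Product.Base using (Σ; ∃-syntax; _×_; _,_; proj₁)
open import Data.Sum.Base using (_⊎_; inj₁; inj₂)
import Data.Vec.Functional.Relation.Binary.Equality.Setoid as VecEquality
open import Function.Bundles using (Inverse)
open import Level using (_⊔_)
import Level
open import Relation.Binary.Bundles using (Setoid)
import Relation.Binary.Construct.On as On
open import Relation.Binary.Core using (Rel)
open import Relation.Binary.Definitions using (Symmetric; _Respects₂_)
open import Relation.Binary.PropositionalEquality using (_≡_; _≢_)
import Relation.Binary.PropositionalEquality as ≡
open import Relation.Binary.Structures using (IsEquivalence)
open import Relation.Nullary.Negation using (¬_)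
open import Relation.Unary using (Pred)

-- Elements are counted up to the equality of the setoid.
HasCardinality : ∀ {a ℓ} → Setoid a ℓ → ℕ → Set (a ⊔ ℓ)
HasCardinality S n = Inverse (≡.setoid (Fin n)) S

Finite : ∀ {a ℓ} → Setoid a ℓ → Set (a ⊔ ℓ)
Finite S = ∃[ n ] HasCardinality S n

-- Two members of the subset are identified whenever the underlying
-- elements are equal, whatever the proofs of membership.
subsetoid : ∀ {a ℓ p} (S : Setoid a ℓ) →
            Pred (Setoid.Carrier S) p → Setoid (a ⊔ p) ℓ
subsetoid S P = On.setoid {B = Σ (Setoid.Carrier S) P} S proj₁

record SimpleGraph v ℓ e : Set (Level.suc (v ⊔ ℓ ⊔ e)) where
  infix 4 _~_
  field
    vertices : Setoid v ℓ
  open Setoid vertices public using (_≈_) renaming (Carrier to Vertex)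
  field
    _~_      : Rel Vertex e
    ~-sym    : Symmetric _~_
    ~-irrefl : ∀ {x y} → x ~ y → ¬ (x ≈ y)
    ~-resp-≈ : _~_ Respects₂ _≈_

module _ {v ℓ e} (Γ : SimpleGraph v ℓ e) where
  open SimpleGraph Γ

  data Walk : ℕ → Rel Vertex (v ⊔ ℓ ⊔ e) where
    nil  : ∀ {x y} → x ≈ y → Walk 0 x y
    cons : ∀ {k x y z} → x ~ y → Walk k y z → Walk (suc k) x z

  Connected : Set (v ⊔ ℓ ⊔ e)
  Connected = ∀ x y → ∃[ k ] Walk k x y

  AtDistance : ℕ → Rel Vertex (v ⊔ ℓ ⊔ e)
  AtDistance d x y = Walk d x y × (∀ k → Walk k x y → d ≤ k)

  NeighbourAtDistance : ℕ → (x y : Vertex) → Pred Vertex (v ⊔ ℓ ⊔ e)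
  NeighbourAtDistance d x y z = (y ~ z) × AtDistance d x z

  -- The neighbours of y at distance d − 1 from x; there are none when
  -- d = 0, since distances are nonnegative.
  NeighbourAtPredDistance : ℕ → (x y : Vertex) → Pred Vertex (v ⊔ ℓ ⊔ e)
  NeighbourAtPredDistance d x y z =
    ∃[ d′ ] (suc d′ ≡ d × NeighbourAtDistance d′ x y z)

  NumberOf : ∀ {p} → Pred Vertex p → ℕ → Set (v ⊔ ℓ ⊔ p)
  NumberOf P = HasCardinality (subsetoid vertices P)

  DistanceRegular : Set (v ⊔ ℓ ⊔ e)
  DistanceRegular =
    Finite vertices × Connected ×
    (∀ d → ∃[ c ] ∃[ a ] ∃[ b ] (∀ x y → AtDistance d x y →
       NumberOf (NeighbourAtPredDistance d x y) c ×
       NumberOf (NeighbourAtDistance d x y) a ×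
       NumberOf (NeighbourAtDistance (suc d) x y) b))

module _ {c ℓ} (G : Group c ℓ) (m : ℕ) where
  open Group G
  open GroupProperties G using (\\-leftDividesʳ)
  open VecEquality setoid using (≋-setoid)

  -- Tuples are functions Fin m → Carrier, compared pointwise.
  Ω : Setoid c ℓ
  Ω = ≋-setoid m

  open Setoid Ω using () renaming
    (Carrier to Tuple; _≈_ to _≋_; sym to ≋-sym; trans to ≋-trans)

  -- The partitions are given as equivalence relations.  The coordinate
  -- partitions are Q i for i : Fin m, so Q zero concerns the first
  -- coordinate; the diagonal partition is the separate Q₀.
  Q : Fin m → Rel Tuple ℓ
  Q i g h = ∀ j → j ≢ i → g j ≈ h j

  Q₀ : Rel Tuple (c ⊔ ℓ)
  Q₀ g h = ∃[ x ] (∀ i → h i ≈ x ∙ g i)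

  Q-isEquivalence : ∀ i → IsEquivalence (Q i)
  Q-isEquivalence i = record
    { refl  = λ _ _ → refl
    ; sym   = λ p j j≢i → sym (p j j≢i)
    ; trans = λ p q j j≢i → trans (p j j≢i) (q j j≢i)
    }

  Q₀-isEquivalence : IsEquivalence Q₀
  Q₀-isEquivalence = record
    { refl  = ε , λ _ → sym (identityˡ _)
    ; sym   = λ (x , p) → x ⁻¹ , λ i →
        trans (sym (\\-leftDividesʳ x _)) (∙-congˡ (sym (p i)))
    ; trans = λ (x , p) (y , q) → y ∙ x , λ i →
        trans (q i) (trans (∙-congˡ (p i)) (sym (assoc y x _)))
    }

  SamePart : Rel Tuple (c ⊔ ℓ)
  SamePart g h = Q₀ g h ⊎ ∃[ i ] Q i g h

  Adjacent : Rel Tuple (c ⊔ ℓ)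
  Adjacent g h = ¬ (g ≋ h) × SamePart g h

  private
    samePart-sym : Symmetric SamePart
    samePart-sym (inj₁ p)       = inj₁ (IsEquivalence.sym Q₀-isEquivalence p)
    samePart-sym (inj₂ (i , p)) = inj₂ (i , IsEquivalence.sym (Q-isEquivalence i) p)

    adjacent-sym : Symmetric Adjacent
    adjacent-sym (g≉h , s) = (λ h≋g → g≉h (≋-sym h≋g)) , samePart-sym s

    samePart-respʳ : ∀ {g h k} → h ≋ k → SamePart g h → SamePart g k
    samePart-respʳ h≋k (inj₁ (x , p)) = inj₁ (x , λ i → trans (sym (h≋k i)) (p i))
    samePart-respʳ h≋k (inj₂ (i , p)) = inj₂ (i , λ j j≢i → trans (p j j≢i) (h≋k j))

    adjacent-respʳ : ∀ {g h k} → h ≋ k → Adjacent g h → Adjacent g k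
    adjacent-respʳ h≋k (g≉h , s) =
      (λ g≋k → g≉h (≋-trans g≋k (≋-sym h≋k))) , samePart-respʳ h≋k s

  ΓD : SimpleGraph c ℓ (c ⊔ ℓ)
  ΓD = record
    { vertices = Ω
    ; _~_      = Adjacent
    ; ~-sym    = adjacent-sym
    ; ~-irrefl = λ (g≉h , _) → g≉h
    ; ~-resp-≈ = adjacent-respʳ
               , λ g≋k a → adjacent-sym (adjacent-respʳ g≋k (adjacent-sym a))
    }

{-# OPTIONS --safe #-}
module Submission where

-- Let N = m + 1, and extend every tuple by a coordinate 0 with entry ε.  A
-- vertex z then has, relative to a vertex x, a profile p : Fin N → G with
-- z j = t p(j) x(j) for some t, unique up to left translation, and the
-- neighbours of z are given by changing a single entry of p: an entry other
-- than 0 for Q_1, ..., Q_m, and entry 0 (after renormalisation) for Q_0.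
-- Hence the distance from x to z is the number of misses min_w #{ j | p j ≠ w }.
-- If this is d, let K be the number of minimising w, and E the number of w
-- with at least d + 2 misses.  Then z has K d neighbours closer to x and
-- [K = 1] (N − d) E neighbours farther away.  For |G| = 2 or N = 3 both K and E
-- are determined by d.  Otherwise N ≥ 4 and |G| ≥ 3, and we write the
-- multiplicities of the values of two profiles with the same d:  if N = 2 M,
-- then (M, M) has K = 2, but (M, M − 1, 1) has K = 1; if N = 2 M − 1, then
-- K = 1 in both cases, but (M, M − 1) has E = |G| − 2 and (M, M − 2, 1) has
-- E = |G| − 1.

open import Defs
open import Algebra.Bundles using (Group)
open import Data.Nat.Base using (ℕ; _≤_)
open import Data.Sum.Base using (_⊎_)
open import Function.Bundles using (_⇔_)
open import Relation.Binary.PropositionalEquality using (_≡_)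

import Algebra.Properties.CommutativeSemigroup as CommutativeSemigroupProperties
import Algebra.Properties.Group as GroupProperties
import Algebra.Properties.Semiring.Sum as SemiringSum
open import Data.Bool.Base using (if_then_else_)
open import Data.Fin.Base using (Fin; zero; suc; punchIn; combine; remQuot; finToFun; funToFin; _↑ˡ_; _↑ʳ_)
open import Data.Fin.Permutation using (↔⇒≡)
open import Data.Fin.Properties using (_≟_; any?; all?; punchInᵢ≢i; punchIn-punchOut)
import Data.Fin.Properties as Fin
open import Data.Nat.Base using (zero; suc; _+_; _*_; _∸_; _^_; _<_; z≤n; s≤s; s≤s⁻¹)
open import Data.Nat.Properties using (_≤?_; +-*-semiring; +-commutativeSemigroup)
import Data.Nat.Properties as ℕ
open import Data.Product.Base using (Σ; ∃; ∃₂; ∃-syntax; _×_; _,_; proj₁; proj₂; uncurry)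
open import Data.Sum.Base using (inj₁; inj₂)
open import Data.Vec.Functional using (Vector; updateAt; _++_)
open import Data.Vec.Functional.Properties using (updateAt-updates; updateAt-minimal; lookup-++ˡ; lookup-++ʳ)
open import Function.Base using (_∘_; const)
open import Function.Bundles using (Inverse; Equivalence; mk⇔)
open import Function.Construct.Composition using (inverse)
open import Function.Construct.Symmetry using () renaming (inverse to symmetry)
open import Relation.Binary.Bundles using (Setoid)
open import Relation.Binary.PropositionalEquality using (_≢_; _≗_; refl; sym; trans; cong; cong₂; subst; module ≡-Reasoning)
import Relation.Binary.PropositionalEquality as ≡
open import Relation.Nullary.Decidable using (Dec; yes; no; does; ¬?; _×-dec_)
open import Relation.Nullary.Negation using (¬_; contradiction)
open import Relation.Unary using (Pred; Decidable)

open SemiringSum +-*-semiring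
open CommutativeSemigroupProperties +-commutativeSemigroup using (x∙yz≈y∙xz)

-- Counting

𝟙 : ∀ {p} {P : Set p} → Dec P → ℕ
𝟙 P? = if does P? then 1 else 0

module _ {p} {P : Set p} where

  𝟙-yes : (P? : Dec P) → P → 𝟙 P? ≡ 1
  𝟙-yes (yes _) _ = refl
  𝟙-yes (no ¬p) p = contradiction p ¬p

  𝟙-no : (P? : Dec P) → ¬ P → 𝟙 P? ≡ 0
  𝟙-no (yes p) ¬p = contradiction p ¬p
  𝟙-no (no _)  _  = refl

  𝟙-¬ : (P? : Dec P) → 𝟙 P? + 𝟙 (¬? P?) ≡ 1
  𝟙-¬ (yes _) = refl
  𝟙-¬ (no _)  = refl

𝟙-cong : ∀ {p q} {P : Set p} {Q : Set q} (P? : Dec P) (Q? : Dec Q) →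
         (P → Q) → (Q → P) → 𝟙 P? ≡ 𝟙 Q?
𝟙-cong (yes p) Q? f g = sym (𝟙-yes Q? (f p))
𝟙-cong (no ¬p) Q? f g = sym (𝟙-no Q? (¬p ∘ g))

𝟙-× : ∀ {p q} {P : Set p} {Q : Set q} (P? : Dec P) (Q? : Dec Q) →
      𝟙 (P? ×-dec Q?) ≡ 𝟙 P? * 𝟙 Q?
𝟙-× (yes _) (yes _) = refl
𝟙-× (yes _) (no _)  = refl
𝟙-× (no _)  _       = refl

-- Where the indicator vanishes the weight is irrelevant, so in a sum over a decidable set a weight
-- may be replaced by its constant value there.
𝟙-weight : ∀ {p} {P : Set p} (P? : Dec P) {x y} → (P → x ≡ y) → x * 𝟙 P? ≡ 𝟙 P? * y
𝟙-weight (yes p) {x} {y} x≡y = trans (ℕ.*-comm x 1) (cong (1 *_) (x≡y p))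
𝟙-weight (no _)  {x}     _   = ℕ.*-zeroʳ x

sum-const : ∀ k c → sum {k} (const c) ≡ k * c
sum-const zero    c = refl
sum-const (suc k) c = cong (c +_) (sum-const k c)

sum-++ : ∀ k {l} (f : Vector ℕ (k + l)) → sum f ≡ sum (f ∘ (_↑ˡ l)) + sum (f ∘ (k ↑ʳ_))
sum-++ zero    f = refl
sum-++ (suc k) f = trans (cong (f zero +_) (sum-++ k (f ∘ suc))) (sym (ℕ.+-assoc (f zero) _ _))

sum-combine : ∀ k l (f : Vector ℕ (k * l)) → sum f ≡ ∑[ i < k ] ∑[ j < l ] f (combine i j)
sum-combine zero    l f = refl
sum-combine (suc k) l f = trans (sum-++ l f)
  (cong (∑[ j < l ] f (combine {suc k} zero j) +_) (sum-combine k l (f ∘ (l ↑ʳ_))))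

count : ∀ {k p} {P : Pred (Fin k) p} → Decidable P → ℕ
count P? = sum (λ i → 𝟙 (P? i))

count-cong : ∀ {k p q} {P : Pred (Fin k) p} {Q : Pred (Fin k) q}
             (P? : Decidable P) (Q? : Decidable Q) →
             (∀ i → P i → Q i) → (∀ i → Q i → P i) → count P? ≡ count Q?
count-cong P? Q? f g = sum-cong-≗ (λ i → 𝟙-cong (P? i) (Q? i) (f i) (g i))

module _ {k p} {P : Pred (Fin k) p} (P? : Decidable P) where

  count-all : (∀ i → P i) → count P? ≡ k
  count-all all = trans (sum-cong-≗ (λ i → 𝟙-yes (P? i) (all i))) (trans (sum-const k 1) (ℕ.*-identityʳ k))

  count-none : (∀ i → ¬ P i) → count P? ≡ 0
  count-none none = trans (sum-cong-≗ (λ i → 𝟙-no (P? i) (none i))) (sum-replicate-zero k)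

  count-¬ : count P? + count (¬? ∘ P?) ≡ k
  count-¬ = trans (sym (∑-distrib-+ (𝟙 ∘ P?) _))
    (trans (sum-cong-≗ (𝟙-¬ ∘ P?)) (trans (sum-const k 1) (ℕ.*-identityʳ k)))

  count-any : count P? ≢ 0 → ∃ P
  count-any ≢0 with any? P?
  ... | yes p = p
  ... | no ¬p = contradiction (count-none (λ i p → ¬p (i , p))) ≢0

count-remove : ∀ {k p} {P : Pred (Fin (suc k)) p} (P? : Decidable P) {u} → P u →
               count P? ≡ suc (count (P? ∘ punchIn u))
count-remove P? {u} pu = trans (sum-remove {i = u} (𝟙 ∘ P?)) (cong (_+ count (P? ∘ punchIn u)) (𝟙-yes (P? u) pu))

count-positive : ∀ {k p} {P : Pred (Fin k) p} (P? : Decidable P) {u} → P u → count P? ≢ 0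
count-positive {suc _} P? pu eq with () ← trans (sym (count-remove P? pu)) eq

count≡1⇒unique : ∀ {k p} {P : Pred (Fin k) p} (P? : Decidable P) → count P? ≡ 1 →
                 ∀ {u v} → P u → P v → v ≡ u
count≡1⇒unique {suc k} {P = P} P? ≡1 {u} {v} pu pv with v ≟ u
... | yes v≡u = v≡u
... | no  v≢u = contradiction (ℕ.suc-injective (trans (sym (count-remove P? pu)) ≡1))
      (count-positive (P? ∘ punchIn u) (subst P (sym (punchIn-punchOut (v≢u ∘ sym))) pv))

unique⇒count≡1 : ∀ {k p} {P : Pred (Fin k) p} (P? : Decidable P) {u} → P u →
                 (∀ v → P v → v ≡ u) → count P? ≡ 1
unique⇒count≡1 {suc k} P? {u} pu unique = trans (count-remove P? pu)
  (cong suc (count-none (P? ∘ punchIn u) (λ j pj → punchInᵢ≢i u j (unique _ pj))))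

count≢1⇒another : ∀ {k p} {P : Pred (Fin k) p} (P? : Decidable P) {u} → P u → count P? ≢ 1 →
                  ∃[ v ] (v ≢ u × P v)
count≢1⇒another {suc k} P? {u} pu ≢1
  with j , pj ← count-any (P? ∘ punchIn u) (λ ≡0 → ≢1 (trans (count-remove P? pu) (cong suc ≡0)))
  = punchIn u j , punchInᵢ≢i u j , pj

-- Cardinalities of setoids and of their subsets.

module _ {a ℓ} (S : Setoid a ℓ) where
  private module S = Setoid S
  open S using (Carrier; _≈_)

  mkCardinality : ∀ {k} (to : Fin k → Carrier) (from : Carrier → Fin k) →
                  (∀ {x y} → x ≈ y → from x ≡ from y) → (∀ x → to (from x) ≈ x) →
                  (∀ i → from (to i) ≡ i) →
                  HasCardinality S k
  mkCardinality to from from-cong to-from from-to = record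
    { to        = to
    ; from      = from
    ; to-cong   = λ { refl → S.refl }
    ; from-cong = from-cong
    ; inverse   = (λ { refl → to-from _ }) , (λ y≈ → trans (from-cong y≈) (from-to _))
    }

  cardinality-unique : ∀ {k l} → HasCardinality S k → HasCardinality S l → k ≡ l
  cardinality-unique e f = ↔⇒≡ (inverse e (symmetry f))

  subset-cardinality-cong :
    ∀ {p q k} {P : Pred Carrier p} {Q : Pred Carrier q} →
    (∀ {x} → P x → Q x) → (∀ {x} → Q x → P x) →
    HasCardinality (subsetoid S P) k → HasCardinality (subsetoid S Q) k
  subset-cardinality-cong P⇒Q Q⇒P e = inverse e record
    { to        = λ (x , p) → x , P⇒Q p
    ; from      = λ (x , q) → x , Q⇒P q
    ; to-cong   = λ x≈y → x≈y
    ; from-cong = λ x≈y → x≈y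
    ; inverse   = (λ x≈y → x≈y) , (λ x≈y → x≈y)
    }

-- The members are enumerated in increasing order. As `subsetoid` compares only the underlying
-- indices, any membership proof can accompany an index.
subset-cardinality : ∀ {k p} {P : Pred (Fin k) p} (P? : Decidable P) →
                     HasCardinality (subsetoid (≡.setoid (Fin k)) P) (count P?)
subset-cardinality {zero}  P? = mkCardinality _ (λ ()) (λ ()) (λ { {()} }) (λ ()) (λ ())
subset-cardinality {suc k} {P = P} P? with P? zero | subset-cardinality (P? ∘ suc)
... | yes p | e = mkCardinality _ to from from-cong to-from from-to
  where
  module e = Inverse e
  to : Fin (suc _) → Σ (Fin (suc k)) P
  to zero    = zero , p
  to (suc j) = suc (proj₁ (e.to j)) , proj₂ (e.to j)
  from : Σ (Fin (suc k)) P → Fin (suc _)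
  from (zero  , _) = zero
  from (suc i , q) = suc (e.from (i , q))
  from-cong : ∀ {x y} → proj₁ x ≡ proj₁ y → from x ≡ from y
  from-cong {zero  , _} {zero  , _} _    = refl
  from-cong {suc i , _} {suc i , _} refl = cong suc (e.from-cong refl)
  to-from : ∀ x → proj₁ (to (from x)) ≡ proj₁ x
  to-from (zero  , _) = refl
  to-from (suc i , q) = cong suc (e.strictlyInverseˡ (i , q))
  from-to : ∀ j → from (to j) ≡ j
  from-to zero    = refl
  from-to (suc j) = cong suc (e.strictlyInverseʳ j)
... | no ¬p | e = mkCardinality _ to from from-cong to-from e.strictlyInverseʳ
  where
  module e = Inverse e
  to : Fin _ → Σ (Fin (suc k)) P
  to j = suc (proj₁ (e.to j)) , proj₂ (e.to j)
  from : Σ (Fin (suc k)) P → Fin _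
  from (zero  , q) = contradiction q ¬p
  from (suc i , q) = e.from (i , q)
  from-cong : ∀ {x y} → proj₁ x ≡ proj₁ y → from x ≡ from y
  from-cong {zero  , q} {_}         _    = contradiction q ¬p
  from-cong {suc i , _} {suc i , _} refl = e.from-cong refl
  to-from : ∀ x → proj₁ (to (from x)) ≡ proj₁ x
  to-from (zero  , q) = contradiction q ¬p
  to-from (suc i , q) = cong suc (e.strictlyInverseˡ (i , q))

module _ {a ℓ} (S : Setoid a ℓ) where
  private module S = Setoid S
  open S using (Carrier; _≈_)

  -- The index that `complete` returns may depend on the proof of membership; injectivity on `P`
  -- removes this dependence and makes the inverse well defined.
  parametrized-cardinality :
    ∀ {k p q} {P : Pred (Fin k) p} {Q : Pred Carrier q}
    (P? : Decidable P) (e : Fin k → Carrier) → (∀ {i} → P i → Q (e i)) →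
    (∀ {i j} → P i → P j → e i ≈ e j → i ≡ j) → (∀ {x} → Q x → ∃[ i ] (P i × e i ≈ x)) →
    HasCardinality (subsetoid S Q) (count P?)
  parametrized-cardinality {P = P} {Q} P? e sound injective complete =
    inverse (subset-cardinality P?) record
      { to        = λ (i , p) → e i , sound p
      ; from      = λ (x , q) → let i , p , _ = complete q in i , p
      ; to-cong   = λ { refl → S.refl }
      ; from-cong = λ {(x , q)} {(y , r)} x≈y → from-cong q r x≈y
      ; inverse   = (λ { {x , q} refl → proj₂ (proj₂ (complete q)) })
                  , (λ { {i , p} {y , q} y≈ → from-cong₁ p q y≈ })
      }
    where
    from-cong₁ : ∀ {i y} → P i → (q : Q y) → y ≈ e i → proj₁ (complete q) ≡ i
    from-cong₁ p q y≈ with j , pj , ej≈ ← complete q = injective pj p (S.trans ej≈ y≈)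
    from-cong : ∀ {x y} (q : Q x) (r : Q y) → x ≈ y → proj₁ (complete q) ≡ proj₁ (complete r)
    from-cong q r x≈y with j , pj , ej≈ ← complete r = from-cong₁ pj q (S.trans x≈y (S.sym ej≈))

-- Profiles

infixl 10 _[_≔_]

_[_≔_] : ∀ {a} {A : Set a} {k} → Vector A k → Fin k → A → Vector A k
p [ i ≔ w ] = updateAt p i (const w)

module _ {N n : ℕ} where

  hits misses : Vector (Fin n) N → Fin n → ℕ
  hits   p w = count (λ j → p j ≟ w)
  misses p w = count (λ j → ¬? (p j ≟ w))

  -- The distance from p to the set of constant vectors.
  LeastMisses : Vector (Fin n) N → ℕ → Set
  LeastMisses p d = (∃[ w ] misses p w ≡ d) × (∀ w → d ≤ misses p w)

  leastMisses? : ∀ p → Decidable (LeastMisses p)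
  leastMisses? p d = any? (λ w → misses p w ℕ.≟ d) ×-dec all? (λ w → d ≤? misses p w)

  leastMisses-unique : ∀ {p d d′} → LeastMisses p d → LeastMisses p d′ → d ≡ d′
  leastMisses-unique ((_ , refl) , d≤) ((_ , refl) , d′≤) = ℕ.≤-antisym (d≤ _) (d′≤ _)

  hits+misses : ∀ p w → hits p w + misses p w ≡ N
  hits+misses p w = count-¬ (λ j → p j ≟ w)

  misses≤N : ∀ p w → misses p w ≤ N
  misses≤N p w = subst (misses p w ≤_) (hits+misses p w) (ℕ.m≤n+m (misses p w) (hits p w))

-- The indicators of the old and the new entry are added crosswise, so that no subtraction and no
-- case distinction arises. The next lemmas evaluate them.
misses-update : ∀ {N n} (p : Vector (Fin n) N) i w v →
                𝟙 (¬? (p i ≟ v)) + misses (p [ i ≔ w ]) v ≡ 𝟙 (¬? (w ≟ v)) + misses p v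
misses-update p zero    w v = x∙yz≈y∙xz (𝟙 (¬? (p zero ≟ v))) (𝟙 (¬? (w ≟ v))) _
misses-update p (suc i) w v = begin
  a + (b + misses (p′ [ i ≔ w ]) v) ≡⟨ x∙yz≈y∙xz a b _ ⟩
  b + (a + misses (p′ [ i ≔ w ]) v) ≡⟨ cong (b +_) (misses-update p′ i w v) ⟩
  b + (c + misses p′ v)             ≡⟨ x∙yz≈y∙xz b c _ ⟩
  c + (b + misses p′ v)             ∎
  where
  open ≡-Reasoning
  p′ = p ∘ suc
  a = 𝟙 (¬? (p (suc i) ≟ v))
  b = 𝟙 (¬? (p zero ≟ v))
  c = 𝟙 (¬? (w ≟ v))

module _ {N n} (p : Vector (Fin n) N) {i : Fin N} {w : Fin n} where

  private
    p′ = p [ i ≔ w ]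

  misses-update-new : p i ≢ w → suc (misses p′ w) ≡ misses p w
  misses-update-new pi≢w = begin
    suc (misses p′ w)                ≡⟨ cong (_+ misses p′ w) (𝟙-yes (¬? (p i ≟ w)) pi≢w) ⟨
    𝟙 (¬? (p i ≟ w)) + misses p′ w   ≡⟨ misses-update p i w w ⟩
    𝟙 (¬? (w ≟ w)) + misses p w      ≡⟨ cong (_+ misses p w) (𝟙-no (¬? (w ≟ w)) (λ w≢w → w≢w refl)) ⟩
    misses p w                       ∎
    where open ≡-Reasoning

  misses-update-old : p i ≢ w → misses p′ (p i) ≡ suc (misses p (p i))
  misses-update-old pi≢w = begin
    misses p′ (p i)                          ≡⟨ cong (_+ misses p′ (p i)) (𝟙-no (¬? (p i ≟ p i)) (λ ≢ → ≢ refl)) ⟨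
    𝟙 (¬? (p i ≟ p i)) + misses p′ (p i)     ≡⟨ misses-update p i w (p i) ⟩
    𝟙 (¬? (w ≟ p i)) + misses p (p i)        ≡⟨ cong (_+ misses p (p i)) (𝟙-yes (¬? (w ≟ p i)) (pi≢w ∘ sym)) ⟩
    suc (misses p (p i))                     ∎
    where open ≡-Reasoning

  misses-update-other : ∀ {v} → v ≢ p i → v ≢ w → misses p′ v ≡ misses p v
  misses-update-other {v} v≢pi v≢w = ℕ.suc-injective (begin
    suc (misses p′ v)               ≡⟨ cong (_+ misses p′ v) (𝟙-yes (¬? (p i ≟ v)) (v≢pi ∘ sym)) ⟨
    𝟙 (¬? (p i ≟ v)) + misses p′ v  ≡⟨ misses-update p i w v ⟩
    𝟙 (¬? (w ≟ v)) + misses p v     ≡⟨ cong (_+ misses p v) (𝟙-yes (¬? (w ≟ v)) (v≢w ∘ sym)) ⟩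
    suc (misses p v)                ∎)
    where open ≡-Reasoning

  misses-update-≥ : ∀ {v} → p i ≢ w → v ≢ w → misses p v ≤ misses p′ v
  misses-update-≥ {v} pi≢w v≢w with v ≟ p i
  ... | yes refl = ℕ.≤-trans (ℕ.n≤1+n _) (ℕ.≤-reflexive (sym (misses-update-old pi≢w)))
  ... | no v≢pi  = ℕ.≤-reflexive (sym (misses-update-other v≢pi v≢w))

  -- Only the new value can lose a miss, and it loses just one. This bounds the length of walks from
  -- below.
  misses-update-suc : ∀ v → p i ≢ w → misses p v ≤ suc (misses p′ v)
  misses-update-suc v pi≢w with v ≟ w
  ... | yes refl = ℕ.≤-reflexive (sym (misses-update-new pi≢w))
  ... | no v≢w   = ℕ.m≤n⇒m≤1+n (misses-update-≥ pi≢w v≢w)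

-- How the change of one entry moves the distance.

module _ {N n} (p : Vector (Fin n) N) (d : ℕ) where

  -- These are K and E of the opening comment, taken at a given `d`.
  minimizers distant : ℕ
  minimizers = count (λ w → misses p w ℕ.≟ d)
  distant    = count (λ w → (2 + d) ≤? misses p w)

  -- To move away, every value must end with at least `d + 1` misses. So the overwritten entry has
  -- to be the only minimiser, and the new value, which loses a miss, has to start from `2 + d` or
  -- more.
  Closer Farther : Fin N → Fin n → Set
  Closer  i w = p i ≢ w × misses p w ≡ d
  Farther i w = (minimizers ≡ 1 × misses p (p i) ≡ d) × 2 + d ≤ misses p w

  closer? : ∀ i w → Dec (Closer i w)
  closer? i w = ¬? (p i ≟ w) ×-dec (misses p w ℕ.≟ d)

  farther? : ∀ i w → Dec (Farther i w)
  farther? i w = ((minimizers ℕ.≟ 1) ×-dec (misses p (p i) ℕ.≟ d)) ×-dec ((2 + d) ≤? misses p w)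

  farther⇒≢ : ∀ {i w} → Farther i w → p i ≢ w
  farther⇒≢ ((_ , refl) , 2+d≤) refl = ℕ.<⇒≱ (ℕ.n<1+n _) (ℕ.≤-trans (ℕ.n≤1+n _) 2+d≤)

  closer⇒¬farther : ∀ {i w} → Closer i w → ¬ Farther i w
  closer⇒¬farther (_ , refl) (_ , 2+d≤) = ℕ.<⇒≱ (ℕ.n<1+n _) (ℕ.≤-trans (ℕ.n≤1+n _) 2+d≤)

  module _ (least : LeastMisses p d) {i w} (pi≢w : p i ≢ w) where

    private
      p′ = p [ i ≔ w ]

      -- If `w` is not a minimiser, it has a miss to spare, and no other value loses one.
      unless-closer : misses p w ≢ d → ∀ v → d ≤ misses p′ v
      unless-closer ≢d v with v ≟ w
      ... | yes refl = s≤s⁻¹ (ℕ.≤-trans (ℕ.≤∧≢⇒< (proj₂ least w) (≢d ∘ sym))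
          (ℕ.≤-reflexive (sym (misses-update-new p pi≢w))))
      ... | no v≢w   = ℕ.≤-trans (proj₂ least v) (misses-update-≥ p pi≢w v≢w)

      another-minimizer : ∀ {u} → misses p w ≢ d → u ≢ p i → misses p u ≡ d → ∃[ v ] misses p′ v ≡ d
      another-minimizer {u} ≢d u≢pi ≡d = u , trans (misses-update-other p u≢pi (λ { refl → ≢d ≡d })) ≡d

    -- The questions are, in turn, whether `w` is a minimiser, whether it is distant, whether `p i`
    -- is a minimiser, and whether it is the only one. A negative answer to any of the last three
    -- leaves a value with `d` misses: `w` itself, falling from `d + 1`, or a minimiser that the
    -- change does not touch.
    classify : (Closer i w × ∃[ e ] (d ≡ suc e × LeastMisses p′ e)) ⊎
               (Farther i w × LeastMisses p′ (suc d)) ⊎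
               ((¬ Closer i w × ¬ Farther i w) × LeastMisses p′ d)
    classify with misses p w ℕ.≟ d
    ... | yes ≡d = inj₁ ((pi≢w , ≡d) , misses p′ w , d≡ , (w , refl) , λ v →
            s≤s⁻¹ (ℕ.≤-trans (ℕ.≤-reflexive (sym d≡))
              (ℕ.≤-trans (proj₂ least v) (misses-update-suc p v pi≢w))))
      where d≡ = trans (sym ≡d) (sym (misses-update-new p pi≢w))
    ... | no ≢d with (2 + d) ≤? misses p w
    ...   | no 2+d≰ = inj₂ (inj₂ ((≢d ∘ proj₂ , 2+d≰ ∘ proj₂) ,
            (w , ℕ.suc-injective ≡1+d) , unless-closer ≢d))
      where
      ≡1+d : suc (misses p′ w) ≡ suc d
      ≡1+d = trans (misses-update-new p pi≢w)
               (ℕ.≤-antisym (s≤s⁻¹ (ℕ.≰⇒> 2+d≰)) (ℕ.≤∧≢⇒< (proj₂ least w) (≢d ∘ sym)))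
    ...   | yes 2+d≤ with misses p (p i) ℕ.≟ d
    ...     | no pi≢d = let (u , ≡d) = proj₁ least in
              inj₂ (inj₂ ((≢d ∘ proj₂ , pi≢d ∘ proj₂ ∘ proj₁) ,
                another-minimizer ≢d (λ { refl → pi≢d ≡d }) ≡d , unless-closer ≢d))
    ...     | yes pi≡d with minimizers ℕ.≟ 1
    ...       | no ≢1 = let (u , u≢pi , ≡d) = count≢1⇒another (λ w → misses p w ℕ.≟ d) pi≡d ≢1 in
                inj₂ (inj₂ ((≢d ∘ proj₂ , ≢1 ∘ proj₁ ∘ proj₁) ,
                  another-minimizer ≢d u≢pi ≡d , unless-closer ≢d))
    ...       | yes ≡1 = inj₂ (inj₁ (((≡1 , pi≡d) , 2+d≤) ,
                (p i , trans (misses-update-old p pi≢w) (cong suc pi≡d)) , bound))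
      where
      -- The new value falls from at least `d + 2`, the old one rises from `d`, and any other value
      -- exceeds `d` because the minimiser is unique.
      bound : ∀ v → suc d ≤ misses p′ v
      bound v with v ≟ w
      ... | yes refl = s≤s⁻¹ (ℕ.≤-trans 2+d≤ (ℕ.≤-reflexive (sym (misses-update-new p pi≢w))))
      ... | no v≢w with v ≟ p i
      ...   | yes refl = ℕ.≤-reflexive (trans (cong suc (sym pi≡d)) (sym (misses-update-old p pi≢w)))
      ...   | no v≢pi  = ℕ.≤-trans
              (ℕ.≤∧≢⇒< (proj₂ least v) (λ d≡ →
                v≢pi (count≡1⇒unique (λ w → misses p w ℕ.≟ d) ≡1 pi≡d (sym d≡))))
              (misses-update-≥ p pi≢w v≢w)

sum-δ : ∀ {k} (a : Fin k) (f : Vector ℕ k) → ∑[ w < k ] (𝟙 (a ≟ w) * f w) ≡ f a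
sum-δ {suc k} zero    f = trans (cong₂ _+_ (ℕ.*-identityˡ (f zero)) (sum-replicate-zero k)) (ℕ.+-identityʳ (f zero))
sum-δ {suc k} (suc a) f = sum-δ a (f ∘ suc)

count-≢ : ∀ {k} (a : Fin k) → count (λ w → ¬? (a ≟ w)) ≡ k ∸ 1
count-≢ {suc k} a = ℕ.suc-injective (begin
  suc (count (λ w → ¬? (a ≟ w)))
    ≡⟨ cong (_+ count (λ w → ¬? (a ≟ w))) (unique⇒count≡1 (a ≟_) refl (λ _ → sym)) ⟨
  count (a ≟_) + count (λ w → ¬? (a ≟ w))                ≡⟨ count-¬ (a ≟_) ⟩
  suc k                                                  ∎)
  where open ≡-Reasoning

-- Counting the neighbours of a profile.

module _ {N n} (p : Vector (Fin n) N) where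

  -- What is counted here are changes of one entry. That they correspond to the neighbours in the
  -- graph is shown in `number-of-neighbours`.
  Neighbour : ℕ → Fin N → Fin n → Set
  Neighbour d i w = p i ≢ w × LeastMisses (p [ i ≔ w ]) d

  neighbour? : ∀ d i w → Dec (Neighbour d i w)
  neighbour? d i w = ¬? (p i ≟ w) ×-dec leastMisses? (p [ i ≔ w ]) d

  neighbours : ℕ → ℕ
  neighbours d = ∑[ i < N ] ∑[ w < n ] 𝟙 (neighbour? d i w)

  neighboursPred : ℕ → ℕ
  neighboursPred zero    = 0
  neighboursPred (suc d) = neighbours d

  private
    ∑∑-cong : {f g : Fin N → Fin n → ℕ} → (∀ i w → f i w ≡ g i w) →
              ∑[ i < N ] ∑[ w < n ] f i w ≡ ∑[ i < N ] ∑[ w < n ] g i w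
    ∑∑-cong f≗g = sum-cong-≗ (λ i → sum-cong-≗ (f≗g i))

    ∑∑-+ : (f g : Fin N → Fin n → ℕ) →
           ∑[ i < N ] ∑[ w < n ] (f i w + g i w) ≡ ∑[ i < N ] ∑[ w < n ] f i w + ∑[ i < N ] ∑[ w < n ] g i w
    ∑∑-+ f g = trans (sum-cong-≗ (λ i → ∑-distrib-+ (f i) (g i)))
      (∑-distrib-+ (λ i → sum (f i)) (λ i → sum (g i)))

    ∑∑-weighted : (f : Fin N → Fin n → ℕ) (g : Vector ℕ n) →
                  ∑[ i < N ] ∑[ w < n ] (f i w * g w) ≡ ∑[ w < n ] (∑[ i < N ] f i w * g w)
    ∑∑-weighted f g = trans (∑-comm (λ i w → f i w * g w))
      (sum-cong-≗ (λ w → sym (*-distribʳ-sum (g w) (λ i → f i w))))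

  ∑-minimizers : ∀ d (f : Vector ℕ n) {c} → (∀ w → misses p w ≡ d → f w ≡ c) →
                 ∑[ w < n ] (f w * 𝟙 (misses p w ℕ.≟ d)) ≡ minimizers p d * c
  ∑-minimizers d f {c} f≡c = begin
    ∑[ w < n ] (f w * 𝟙 (misses p w ℕ.≟ d)) ≡⟨ sum-cong-≗ (λ w → 𝟙-weight (misses p w ℕ.≟ d) (f≡c w)) ⟩
    ∑[ w < n ] (𝟙 (misses p w ℕ.≟ d) * c)   ≡⟨ *-distribʳ-sum c (λ w → 𝟙 (misses p w ℕ.≟ d)) ⟨
    minimizers p d * c                      ∎
    where
    open ≡-Reasoning

  -- Each minimiser can be written over any of its `d` misses.
  ∑∑-closer : ∀ d → ∑[ i < N ] ∑[ w < n ] 𝟙 (closer? p d i w) ≡ minimizers p d * d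
  ∑∑-closer d = begin
    ∑[ i < N ] ∑[ w < n ] 𝟙 (closer? p d i w)
      ≡⟨ ∑∑-cong (λ i w → 𝟙-× (¬? (p i ≟ w)) (misses p w ℕ.≟ d)) ⟩
    ∑[ i < N ] ∑[ w < n ] (𝟙 (¬? (p i ≟ w)) * 𝟙 (misses p w ℕ.≟ d))
      ≡⟨ ∑∑-weighted (λ i w → 𝟙 (¬? (p i ≟ w))) (λ w → 𝟙 (misses p w ℕ.≟ d)) ⟩
    ∑[ w < n ] (misses p w * 𝟙 (misses p w ℕ.≟ d))
      ≡⟨ ∑-minimizers d (misses p) (λ _ ≡d → ≡d) ⟩
    minimizers p d * d                                                      ∎
    where open ≡-Reasoning

  -- Each minimiser occupies the `N ∸ d` entries that it does not miss.
  ∑-minimal-entries : ∀ d → count (λ i → misses p (p i) ℕ.≟ d) ≡ minimizers p d * (N ∸ d)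
  ∑-minimal-entries d = begin
    ∑[ i < N ] 𝟙 (misses p (p i) ℕ.≟ d)
      ≡⟨ sum-cong-≗ (λ i → sum-δ (p i) (λ w → 𝟙 (misses p w ℕ.≟ d))) ⟨
    ∑[ i < N ] ∑[ w < n ] (𝟙 (p i ≟ w) * 𝟙 (misses p w ℕ.≟ d))
      ≡⟨ ∑∑-weighted (λ i w → 𝟙 (p i ≟ w)) (λ w → 𝟙 (misses p w ℕ.≟ d)) ⟩
    ∑[ w < n ] (hits p w * 𝟙 (misses p w ℕ.≟ d))                     ≡⟨ ∑-minimizers d (hits p) hits≡ ⟩
    minimizers p d * (N ∸ d)                                         ∎
    where
    open ≡-Reasoning
    hits≡ : ∀ w → misses p w ≡ d → hits p w ≡ N ∸ d
    hits≡ w refl = sym (trans (cong (_∸ misses p w) (sym (hits+misses p w))) (ℕ.m+n∸n≡m (hits p w) (misses p w)))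

  -- The conditions of `Farther` concern the profile, the index and the new value separately, so the
  -- double sum factors. The factor `minimizers p d` is kept although it is 1 whenever the indicator
  -- is, which avoids a case distinction.
  ∑∑-farther : ∀ d → ∑[ i < N ] ∑[ w < n ] 𝟙 (farther? p d i w) ≡
               𝟙 (minimizers p d ℕ.≟ 1) * (minimizers p d * (N ∸ d)) * distant p d
  ∑∑-farther d = begin
    ∑[ i < N ] ∑[ w < n ] 𝟙 (farther? p d i w)
      ≡⟨ ∑∑-cong (λ i w → trans (𝟙-× (k? ×-dec m? i) (e? w)) (cong (_* 𝟙 (e? w)) (𝟙-× k? (m? i)))) ⟩
    ∑[ i < N ] ∑[ w < n ] (𝟙 k? * 𝟙 (m? i) * 𝟙 (e? w))
      ≡⟨ sum-cong-≗ (λ i → *-distribˡ-sum (𝟙 k? * 𝟙 (m? i)) (𝟙 ∘ e?)) ⟨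
    ∑[ i < N ] (𝟙 k? * 𝟙 (m? i) * count e?)             ≡⟨ *-distribʳ-sum (count e?) (λ i → 𝟙 k? * 𝟙 (m? i)) ⟨
    ∑[ i < N ] (𝟙 k? * 𝟙 (m? i)) * count e?             ≡⟨ cong (_* count e?) (*-distribˡ-sum (𝟙 k?) (𝟙 ∘ m?)) ⟨
    𝟙 k? * count m? * count e?                          ≡⟨ cong (λ c → 𝟙 k? * c * count e?) (∑-minimal-entries d) ⟩
    𝟙 k? * (minimizers p d * (N ∸ d)) * count e?        ∎
    where
    open ≡-Reasoning
    k? = minimizers p d ℕ.≟ 1
    m? : Decidable (λ i → misses p (p i) ≡ d)
    m? i = misses p (p i) ℕ.≟ d
    e? : Decidable (λ w → 2 + d ≤ misses p w)
    e? w = (2 + d) ≤? misses p w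

  ∑∑-≢ : ∑[ i < N ] ∑[ w < n ] 𝟙 (¬? (p i ≟ w)) ≡ N * (n ∸ 1)
  ∑∑-≢ = trans (sum-cong-≗ (λ i → count-≢ (p i))) (sum-const N (n ∸ 1))

  private
    unique : ∀ {i w e e′} → LeastMisses (p [ i ≔ w ]) e → LeastMisses (p [ i ≔ w ]) e′ → e ≡ e′
    unique {i} {w} = leastMisses-unique {p = p [ i ≔ w ]}

  -- By `classify`, since a profile has only one distance and the other two outcomes contradict it.
  -- For `d = 0` both sides vanish.
  neighboursPred-count : ∀ {d} → LeastMisses p d → neighboursPred d ≡ minimizers p d * d
  neighboursPred-count {zero}  _     = sym (ℕ.*-zeroʳ (minimizers p 0))
  neighboursPred-count {suc e} least =
    trans (∑∑-cong (λ i w → 𝟙-cong (neighbour? e i w) (closer? p (suc e) i w) (to i w) (from i w)))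
      (∑∑-closer (suc e))
    where
    to : ∀ i w → Neighbour e i w → Closer p (suc e) i w
    to i w (pi≢w , l) with classify p (suc e) least pi≢w
    ... | inj₁ (c , _)              = c
    ... | inj₂ (inj₁ (_ , l′))      = contradiction (unique l l′) (ℕ.<⇒≢ (ℕ.m≤n⇒m≤1+n (ℕ.n<1+n e)))
    ... | inj₂ (inj₂ (_ , l′))      = contradiction (unique l l′) (ℕ.<⇒≢ (ℕ.n<1+n e))
    from : ∀ i w → Closer p (suc e) i w → Neighbour e i w
    from i w c@(pi≢w , _) with classify p (suc e) least pi≢w
    ... | inj₁ (_ , _ , refl , l)          = pi≢w , l
    ... | inj₂ (inj₁ (f , _))              = contradiction f (closer⇒¬farther p _ c)
    ... | inj₂ (inj₂ ((¬c , _) , _))       = contradiction c ¬c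

  module _ {d} (least : LeastMisses p d) where

    neighboursSuc-count : neighbours (suc d) ≡
                          𝟙 (minimizers p d ℕ.≟ 1) * (minimizers p d * (N ∸ d)) * distant p d
    neighboursSuc-count =
      trans (∑∑-cong (λ i w → 𝟙-cong (neighbour? (suc d) i w) (farther? p d i w) (to i w) (from i w)))
        (∑∑-farther d)
      where
      to : ∀ i w → Neighbour (suc d) i w → Farther p d i w
      to i w (pi≢w , l) with classify p d least pi≢w
      ... | inj₁ (_ , _ , refl , l′)  = contradiction (unique l′ l) (ℕ.<⇒≢ (ℕ.m≤n⇒m≤1+n (ℕ.n<1+n _)))
      ... | inj₂ (inj₁ (f , _))       = f
      ... | inj₂ (inj₂ (_ , l′))      = contradiction (unique l′ l) (ℕ.<⇒≢ (ℕ.n<1+n d))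
      from : ∀ i w → Farther p d i w → Neighbour (suc d) i w
      from i w f with classify p d least (farther⇒≢ p d f)
      ... | inj₁ (c , _)                     = contradiction f (closer⇒¬farther p d c)
      ... | inj₂ (inj₁ (_ , l))              = farther⇒≢ p d f , l
      ... | inj₂ (inj₂ ((_ , ¬f) , _))       = contradiction f ¬f

    -- Every proper change belongs to exactly one of the three classes, and each of the `N` entries
    -- has `n ∸ 1` proper changes. This gives the neighbours at equal distance as a remainder.
    neighbours-total : neighbours d + (minimizers p d * d +
                       𝟙 (minimizers p d ℕ.≟ 1) * (minimizers p d * (N ∸ d)) * distant p d) ≡ N * (n ∸ 1)
    neighbours-total = begin
      neighbours d + (minimizers p d * d + 𝟙 (minimizers p d ℕ.≟ 1) * (minimizers p d * (N ∸ d)) * distant p d)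
        ≡⟨ cong (neighbours d +_) (cong₂ _+_ (∑∑-closer d) (∑∑-farther d)) ⟨
      neighbours d + (∑[ i < N ] ∑[ w < n ] 𝟙 (closer? p d i w) + ∑[ i < N ] ∑[ w < n ] 𝟙 (farther? p d i w))
        ≡⟨ cong (neighbours d +_) (∑∑-+ _ _) ⟨
      neighbours d + ∑[ i < N ] ∑[ w < n ] (𝟙 (closer? p d i w) + 𝟙 (farther? p d i w))
        ≡⟨ ∑∑-+ _ _ ⟨
      ∑[ i < N ] ∑[ w < n ] (𝟙 (neighbour? d i w) + (𝟙 (closer? p d i w) + 𝟙 (farther? p d i w)))
        ≡⟨ ∑∑-cong pointwise ⟩
      ∑[ i < N ] ∑[ w < n ] 𝟙 (¬? (p i ≟ w))
        ≡⟨ ∑∑-≢ ⟩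
      N * (n ∸ 1) ∎
      where
      open ≡-Reasoning
      -- Each case below supplies the four indicators as numerals; the remaining equation then holds
      -- by computation.
      values : ∀ i w {a b c e} → 𝟙 (neighbour? d i w) ≡ a → 𝟙 (closer? p d i w) ≡ b →
               𝟙 (farther? p d i w) ≡ c → 𝟙 (¬? (p i ≟ w)) ≡ e → a + (b + c) ≡ e →
               𝟙 (neighbour? d i w) + (𝟙 (closer? p d i w) + 𝟙 (farther? p d i w)) ≡ 𝟙 (¬? (p i ≟ w))
      values i w refl refl refl refl eq = eq
      pointwise : ∀ i w → 𝟙 (neighbour? d i w) + (𝟙 (closer? p d i w) + 𝟙 (farther? p d i w)) ≡
                  𝟙 (¬? (p i ≟ w))
      pointwise i w = by-equality (p i ≟ w)
        where
        by-equality : Dec (p i ≡ w) → _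
        by-equality (yes pi≡w) = values i w
          (𝟙-no (neighbour? d i w) (λ b → proj₁ b pi≡w)) (𝟙-no (closer? p d i w) (λ c → proj₁ c pi≡w))
          (𝟙-no (farther? p d i w) (λ f → farther⇒≢ p d f pi≡w))
          (𝟙-no (¬? (p i ≟ w)) (λ ≢ → ≢ pi≡w)) refl
        by-equality (no pi≢w) with classify p d least pi≢w
        ... | inj₁ (c , e , d≡ , l) = values i w
          (𝟙-no (neighbour? d i w) (λ b → ℕ.<⇒≢ (ℕ.n<1+n e) (trans (unique l (proj₂ b)) d≡)))
          (𝟙-yes (closer? p d i w) c) (𝟙-no (farther? p d i w) (closer⇒¬farther p d c)) (𝟙-yes (¬? (p i ≟ w)) pi≢w) refl
        ... | inj₂ (inj₁ (f , l)) = values i w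
          (𝟙-no (neighbour? d i w) (λ b → ℕ.<⇒≢ (ℕ.n<1+n d) (unique (proj₂ b) l)))
          (𝟙-no (closer? p d i w) (λ c → closer⇒¬farther p d c f))
          (𝟙-yes (farther? p d i w) f) (𝟙-yes (¬? (p i ≟ w)) pi≢w) refl
        ... | inj₂ (inj₂ ((¬c , ¬f) , l)) = values i w
          (𝟙-yes (neighbour? d i w) (pi≢w , l)) (𝟙-no (closer? p d i w) ¬c)
          (𝟙-no (farther? p d i w) ¬f) (𝟙-yes (¬? (p i ≟ w)) pi≢w) refl

-- Distance-regularity expressed through profiles instead of pairs of vertices;
-- `distanceRegular⇔regular` justifies the translation.
Regular : ℕ → ℕ → Set
Regular N n = ∀ d → ∃[ c ] ∃[ a ] ∃[ b ] (∀ (p : Vector (Fin n) N) → LeastMisses p d →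
  neighboursPred p d ≡ c × neighbours p d ≡ a × neighbours p (suc d) ≡ b)

-- The closer and farther counts depend on the profile through K and E alone, and the third count is
-- the rest of `N * (n ∸ 1)`.
uniform⇒regular : ∀ {N n} (κ η : ℕ → ℕ) →
  (∀ d (p : Vector (Fin n) N) → LeastMisses p d → minimizers p d ≡ κ d × distant p d ≡ η d) →
  Regular N n
uniform⇒regular {N} {n} κ η uniform d = c , N * (n ∸ 1) ∸ (c + b) , b , λ p least →
  let minimizers≡ , distant≡ = uniform d p least
      c≡ = cong (_* d) minimizers≡
      b≡ = cong₂ (λ k e → 𝟙 (k ℕ.≟ 1) * (k * (N ∸ d)) * e) minimizers≡ distant≡
      same = ℕ.m+n∸n≡m (neighbours p d)
        (minimizers p d * d + 𝟙 (minimizers p d ℕ.≟ 1) * (minimizers p d * (N ∸ d)) * distant p d)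
  in trans (neighboursPred-count p least) c≡
   , trans (sym same) (cong₂ _∸_ (neighbours-total p least) (cong₂ _+_ c≡ b≡))
   , trans (neighboursSuc-count p least) b≡
  where
  c = κ d * d
  b = 𝟙 (κ d ℕ.≟ 1) * (κ d * (N ∸ d)) * η d

-- Vectors with two values

-- One value has `d` misses and the other `N ∸ d`. The other one is a second minimiser exactly when
-- the two numbers agree, and it alone can be distant.
regular-two-values : ∀ N → Regular N 2
regular-two-values N = uniform⇒regular (λ d → 1 + 𝟙 (N ∸ d ℕ.≟ d)) (λ d → 𝟙 ((2 + d) ≤? (N ∸ d)))
  uniform
  where
  misses₀+misses₁ : ∀ (p : Vector (Fin 2) N) → misses p zero + misses p (suc zero) ≡ N
  misses₀+misses₁ p = begin
    misses p zero + misses p (suc zero)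
      -- Of two values, to miss one is to hit the other.
      ≡⟨ cong (misses p zero +_) (count-cong (λ j → ¬? (p j ≟ suc zero)) (λ j → p j ≟ zero)
           (λ j → ≢1⇒≡0 (p j)) (λ j → ≡0⇒≢1 (p j))) ⟩
    misses p zero + hits p zero         ≡⟨ ℕ.+-comm (misses p zero) (hits p zero) ⟩
    hits p zero + misses p zero         ≡⟨ hits+misses p zero ⟩
    N                                   ∎
    where
    open ≡-Reasoning
    ≢1⇒≡0 : ∀ (x : Fin 2) → x ≢ suc zero → x ≡ zero
    ≢1⇒≡0 zero       _  = refl
    ≢1⇒≡0 (suc zero) ≢1 = contradiction refl ≢1
    ≡0⇒≢1 : ∀ (x : Fin 2) → x ≡ zero → x ≢ suc zero
    ≡0⇒≢1 _ refl ()

  ¬2+d≤d : ∀ d → ¬ 2 + d ≤ d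
  ¬2+d≤d d 2+d≤d = ℕ.<⇒≱ (ℕ.n<1+n d) (ℕ.≤-trans (ℕ.n≤1+n _) 2+d≤d)

  uniform : ∀ d (p : Vector (Fin 2) N) → LeastMisses p d →
            minimizers p d ≡ 1 + 𝟙 (N ∸ d ℕ.≟ d) × distant p d ≡ 𝟙 ((2 + d) ≤? (N ∸ d))
  uniform d p ((zero , ≡d) , _) =
      cong₂ _+_ (𝟙-yes (misses p zero ℕ.≟ d) ≡d)
        (trans (ℕ.+-identityʳ _) (cong (λ x → 𝟙 (x ℕ.≟ d)) other))
    , cong₂ _+_ (𝟙-no ((2 + d) ≤? misses p zero) (¬2+d≤d d ∘ subst (2 + d ≤_) ≡d))
        (trans (ℕ.+-identityʳ _) (cong (λ x → 𝟙 ((2 + d) ≤? x)) other))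
    where
    other : misses p (suc zero) ≡ N ∸ d
    other = trans (sym (ℕ.m+n∸m≡n (misses p zero) _)) (cong₂ _∸_ (misses₀+misses₁ p) ≡d)
  uniform d p ((suc zero , ≡d) , _) =
      trans (cong₂ _+_ (cong (λ x → 𝟙 (x ℕ.≟ d)) other)
          (cong (_+ 0) (𝟙-yes (misses p (suc zero) ℕ.≟ d) ≡d))) (ℕ.+-comm _ 1)
    , trans (cong₂ _+_ (cong (λ x → 𝟙 ((2 + d) ≤? x)) other)
          (cong (_+ 0) (𝟙-no ((2 + d) ≤? misses p (suc zero)) (¬2+d≤d d ∘ subst (2 + d ≤_) ≡d))))
        (ℕ.+-identityʳ _)
    where
    other : misses p zero ≡ N ∸ d
    other = trans (sym (ℕ.m+n∸n≡m (misses p zero) (misses p (suc zero)))) (cong₂ _∸_ (misses₀+misses₁ p) ≡d)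

-- Vectors of length three

-- Double counting: each entry hits exactly one value.
∑-hits : ∀ {N n} (p : Vector (Fin n) N) → sum (hits p) ≡ N
∑-hits {N} {n} p = begin
  ∑[ w < n ] ∑[ i < N ] 𝟙 (p i ≟ w) ≡⟨ ∑-comm (λ w i → 𝟙 (p i ≟ w)) ⟩
  ∑[ i < N ] count (p i ≟_)         ≡⟨ sum-cong-≗ (λ i → unique⇒count≡1 (p i ≟_) refl (λ _ → sym)) ⟩
  ∑[ i < N ] 1                      ≡⟨ trans (sum-const N 1) (ℕ.*-identityʳ N) ⟩
  N                                 ∎
  where open ≡-Reasoning

module _ {n} (p : Vector (Fin n) 3) where

  private
    -- Hits and misses add up to three, so an identity between them needs checking at four pairs
    -- only.
    by-misses : (f g : ℕ → ℕ → ℕ) → f 3 0 ≡ g 3 0 → f 2 1 ≡ g 2 1 → f 1 2 ≡ g 1 2 → f 0 3 ≡ g 0 3 →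
                ∀ w → f (hits p w) (misses p w) ≡ g (hits p w) (misses p w)
    by-misses f g e₀ e₁ e₂ e₃ w = cases (hits p w) (misses p w) (hits+misses p w)
      where
      cases : ∀ x y → x + y ≡ 3 → f x y ≡ g x y
      cases 0 _ refl = e₃
      cases 1 _ refl = e₂
      cases 2 _ refl = e₁
      cases 3 _ refl = e₀
      cases (suc (suc (suc (suc _)))) _ ()

  -- Here `minimizers p e` counts the values with exactly `e` misses, whether or not `e` is the
  -- distance. Such a value has `3 ∸ e` hits, and all hits together number three.
  weighted-minimizers : 3 * minimizers p 0 + (2 * minimizers p 1 + minimizers p 2) ≡ 3
  weighted-minimizers = begin
    3 * sum (at 0) + (2 * sum (at 1) + sum (at 2))
      ≡⟨ cong₂ _+_ (*-distribˡ-sum 3 (at 0)) (cong (_+ sum (at 2)) (*-distribˡ-sum 2 (at 1))) ⟩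
    ∑[ w < n ] (3 * at 0 w) + (∑[ w < n ] (2 * at 1 w) + sum (at 2))
      ≡⟨ cong (∑[ w < n ] (3 * at 0 w) +_) (∑-distrib-+ (λ w → 2 * at 1 w) (at 2)) ⟨
    ∑[ w < n ] (3 * at 0 w) + ∑[ w < n ] (2 * at 1 w + at 2 w)
      ≡⟨ ∑-distrib-+ (λ w → 3 * at 0 w) (λ w → 2 * at 1 w + at 2 w) ⟨
    ∑[ w < n ] (3 * at 0 w + (2 * at 1 w + at 2 w))
      ≡⟨ sum-cong-≗ (by-misses (λ x y → 3 * 𝟙 (y ℕ.≟ 0) + (2 * 𝟙 (y ℕ.≟ 1) + 𝟙 (y ℕ.≟ 2)))
           (λ x y → x) refl refl refl refl) ⟩
    sum (hits p)
      ≡⟨ ∑-hits p ⟩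
    3 ∎
    where
    open ≡-Reasoning
    at : ℕ → Vector ℕ n
    at d w = 𝟙 (misses p w ℕ.≟ d)

  -- The `n` values are sorted into those with 0, with 1 and with at least 2 misses; `distant₁`
  -- splits the last class further.
  distant₀ : minimizers p 0 + (minimizers p 1 + distant p 0) ≡ n
  distant₀ = begin
    sum (at 0) + (sum (at 1) + sum ≥2)          ≡⟨ cong (sum (at 0) +_) (∑-distrib-+ (at 1) ≥2) ⟨
    sum (at 0) + ∑[ w < n ] (at 1 w + ≥2 w)     ≡⟨ ∑-distrib-+ (at 0) (λ w → at 1 w + ≥2 w) ⟨
    ∑[ w < n ] (at 0 w + (at 1 w + ≥2 w))
      ≡⟨ sum-cong-≗ (by-misses (λ _ y → 𝟙 (y ℕ.≟ 0) + (𝟙 (y ℕ.≟ 1) + 𝟙 (2 ≤? y)))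
           (λ _ _ → 1) refl refl refl refl) ⟩
    ∑[ w < n ] 1                                ≡⟨ trans (sum-const n 1) (ℕ.*-identityʳ n) ⟩
    n                                           ∎
    where
    open ≡-Reasoning
    at : ℕ → Vector ℕ n
    at d w = 𝟙 (misses p w ℕ.≟ d)
    ≥2 : Vector ℕ n
    ≥2 w = 𝟙 (2 ≤? misses p w)

  distant₁ : minimizers p 2 + distant p 1 ≡ distant p 0
  distant₁ = trans (sym (∑-distrib-+ (λ w → 𝟙 (misses p w ℕ.≟ 2)) (λ w → 𝟙 (3 ≤? misses p w))))
    (sum-cong-≗ (by-misses (λ _ y → 𝟙 (y ℕ.≟ 2) + 𝟙 (3 ≤? y))
      (λ _ y → 𝟙 (2 ≤? y)) refl refl refl refl))

regular-length-three : ∀ n → Regular 3 n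
regular-length-three n = uniform⇒regular κ η uniform
  where
  κ η : ℕ → ℕ
  κ 0 = 1
  κ 1 = 1
  -- No profile has distance above 2, so only `d = 2` has to fit the default values.
  κ _ = 3
  η 0 = n ∸ 1
  η 1 = n ∸ 2
  η _ = 0

  uniform : ∀ d (p : Vector (Fin n) 3) → LeastMisses p d → minimizers p d ≡ κ d × distant p d ≡ η d
  uniform d p (witness , d≤) = by-distance d (count-positive (λ w → misses p w ℕ.≟ d) (proj₂ witness))
    (λ e<d → count-none (λ w → misses p w ℕ.≟ _)
      (λ w eq → ℕ.<⇒≱ e<d (ℕ.≤-trans (d≤ w) (ℕ.≤-reflexive eq))))
    where
    at-most-one : ∀ {x} → x ≢ 0 → x < 2 → x ≡ 1
    at-most-one x≢0 (s≤s z≤n)       = contradiction refl x≢0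
    at-most-one x≢0 (s≤s (s≤s z≤n)) = refl

    by-distance : ∀ d → minimizers p d ≢ 0 → (∀ {e} → e < d → minimizers p e ≡ 0) →
                  minimizers p d ≡ κ d × distant p d ≡ η d
    by-distance 0 ≢0 _ = c₀≡1 , (begin
      distant p 0                         ≡⟨⟩
      (1 + distant p 0) ∸ 1               ≡⟨ cong₂ (λ x y → (x + (y + distant p 0)) ∸ 1) c₀≡1 c₁≡0 ⟨
      (minimizers p 0 + (minimizers p 1 + distant p 0)) ∸ 1 ≡⟨ cong (_∸ 1) (distant₀ p) ⟩
      n ∸ 1                               ∎)
      where
      open ≡-Reasoning
      c₀≡1 : minimizers p 0 ≡ 1
      c₀≡1 = at-most-one ≢0 (s≤s (ℕ.*-cancelˡ-≤ 3
        (ℕ.m+n≤o⇒m≤o _ (ℕ.≤-reflexive (weighted-minimizers p)))))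
      c₁≡0 : minimizers p 1 ≡ 0
      c₁≡0 = ℕ.m+n≡0⇒m≡0 _ (ℕ.m+n≡0⇒m≡0 _ (ℕ.+-cancelˡ-≡ 3 _ 0
        (trans (cong (λ x → 3 * x + (2 * minimizers p 1 + minimizers p 2)) (sym c₀≡1)) (weighted-minimizers p))))
    by-distance 1 ≢0 0< = c₁≡1 , (begin
      distant p 1                         ≡⟨⟩
      (0 + (1 + (1 + distant p 1))) ∸ 2   ≡⟨ cong (λ x → (0 + (1 + (x + distant p 1))) ∸ 2) c₂≡1 ⟨
      (0 + (1 + (minimizers p 2 + distant p 1))) ∸ 2 ≡⟨ cong (λ x → (0 + (1 + x)) ∸ 2) (distant₁ p) ⟩
      (0 + (1 + distant p 0)) ∸ 2         ≡⟨ cong₂ (λ x y → (x + (y + distant p 0)) ∸ 2) (0< (s≤s z≤n)) c₁≡1 ⟨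
      (minimizers p 0 + (minimizers p 1 + distant p 0)) ∸ 2 ≡⟨ cong (_∸ 2) (distant₀ p) ⟩
      n ∸ 2                               ∎)
      where
      open ≡-Reasoning
      weighted : 2 * minimizers p 1 + minimizers p 2 ≡ 3
      weighted = trans (cong (λ x → 3 * x + (2 * minimizers p 1 + minimizers p 2)) (sym (0< (s≤s z≤n))))
        (weighted-minimizers p)
      c₁≡1 : minimizers p 1 ≡ 1
      -- The count is below 2 because twice the count is at most 3.
      c₁≡1 = at-most-one ≢0 (ℕ.*-cancelˡ-< 2 _ 2 (s≤s (ℕ.m+n≤o⇒m≤o _ (ℕ.≤-reflexive weighted))))
      c₂≡1 : minimizers p 2 ≡ 1
      c₂≡1 = ℕ.+-cancelˡ-≡ 2 _ 1 (trans (cong (λ x → 2 * x + minimizers p 2) (sym c₁≡1)) weighted)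
    by-distance (suc (suc d)) ≢0 0< = c₂≡3 d ≢0 0< , count-none (λ w → (4 + d) ≤? misses p w)
      (λ w 4+d≤ → ℕ.<⇒≱ (s≤s (s≤s (s≤s (s≤s z≤n)))) (ℕ.≤-trans 4+d≤ (misses≤N p w)))
      where
      weighted : minimizers p 2 ≡ 3
      weighted = trans (cong₂ (λ x y → 3 * x + (2 * y + minimizers p 2))
        (sym (0< (s≤s z≤n))) (sym (0< (s≤s (s≤s z≤n))))) (weighted-minimizers p)
      c₂≡3 : ∀ d → minimizers p (2 + d) ≢ 0 → (∀ {e} → e < 2 + d → minimizers p e ≡ 0) →
             minimizers p (2 + d) ≡ 3
      c₂≡3 0       _ _  = weighted
      -- At a distance above 2, the number of values with two misses would be both 3 and 0.
      c₂≡3 (suc d) _ 0< with () ← trans (sym weighted) (0< (s≤s (s≤s (s≤s z≤n))))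

-- Longer vectors with more values

misses-++ : ∀ {k l n} (p : Vector (Fin n) k) (q : Vector (Fin n) l) w →
            misses (p ++ q) w ≡ misses p w + misses q w
misses-++ {k} p q w = trans (sum-++ k (λ i → 𝟙 (¬? ((p ++ q) i ≟ w)))) (cong₂ _+_
  (sum-cong-≗ (λ i → cong (λ u → 𝟙 (¬? (u ≟ w))) (lookup-++ˡ p q i)))
  (sum-cong-≗ (λ i → cong (λ u → 𝟙 (¬? (u ≟ w))) (lookup-++ʳ p q i))))

halve : ∀ j → ∃[ k ] (j ≡ k + k ⊎ j ≡ suc (k + k))
halve zero = 0 , inj₁ refl
halve (suc j) with halve j
... | k , inj₁ refl = k , inj₂ refl
... | k , inj₂ refl = suc k , inj₁ (cong suc (sym (ℕ.+-suc k k)))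

module _ {n : ℕ} where

  private
    0F 1F 2F : Fin (3 + n)
    0F = zero
    1F = suc zero
    2F = suc (suc zero)

  -- A value misses just the blocks of the other values. The length is given by an equation so that
  -- different multiplicities yield vectors of the same type.
  blocks : ∀ {N} a b c → a + (b + c) ≡ N → ∃[ p ] (
    misses {N} {3 + n} p 0F ≡ b + c × misses p 1F ≡ a + c × misses p 2F ≡ a + b ×
    (∀ w → misses p (suc (suc (suc w))) ≡ a + (b + c)))
  blocks a b c refl = block {a} 0F ++ (block {b} 1F ++ block {c} 2F) ,
    by-blocks 0F (c0 a) (c1 b) (c1 c) ,
    by-blocks 1F (c1 a) (c0 b) (c1 c) ,
    trans (by-blocks 2F (c1 a) (c1 b) (c0 c)) (cong (a +_) (ℕ.+-identityʳ b)) ,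
    λ w → by-blocks (suc (suc (suc w))) (c1 a) (c1 b) (c1 c)
    where
    block : ∀ {k} → Fin (3 + n) → Vector (Fin (3 + n)) k
    block u _ = u
    c0 : ∀ k → sum {k} (const 0) ≡ 0
    c0 = sum-replicate-zero
    c1 : ∀ k → sum {k} (const 1) ≡ k
    c1 k = trans (sum-const k 1) (ℕ.*-identityʳ k)
    by-blocks : ∀ w {x y z} → misses (block {a} 0F) w ≡ x → misses (block {b} 1F) w ≡ y →
                misses (block {c} 2F) w ≡ z → misses (block {a} 0F ++ (block {b} 1F ++ block {c} 2F)) w ≡ x + (y + z)
    by-blocks w x≡ y≡ z≡ = trans (misses-++ (block {a} 0F) _ w)
      (cong₂ _+_ x≡ (trans (misses-++ (block {b} 1F) (block {c} 2F) w) (cong₂ _+_ y≡ z≡)))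

  module _ {N} (p : Vector (Fin (3 + n)) N) {d}
           (zero≡d : misses p 0F ≡ d) (d< : ∀ w → d < misses p (suc w)) where

    first-leastMisses : LeastMisses p d
    first-leastMisses = (0F , zero≡d) , λ where
      zero    → ℕ.≤-reflexive (sym zero≡d)
      (suc w) → ℕ.<⇒≤ (d< w)

    first-unique : minimizers p d ≡ 1
    first-unique = unique⇒count≡1 (λ w → misses p w ℕ.≟ d) zero≡d λ where
      zero    _  → refl
      (suc w) ≡d → contradiction (sym ≡d) (ℕ.<⇒≢ (d< w))

  -- This is `M = 2 + k`, with `d = M` for both profiles. The closer counts are K times the positive
  -- number `d`, so equal counts would give `p` a single minimiser, while `0F` and `1F` both are
  -- minimisers.
  irregular-even : ∀ k → ¬ Regular (4 + (k + k)) (3 + n)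
  irregular-even k regular =
    let
      d = 2 + k
      p , p₀ , p₁ , p₂ , p₃ = blocks (2 + k) (2 + k) 0 size-p
      q , q₀ , q₁ , q₂ , q₃ = blocks (2 + k) (1 + k) 1 size-q
      p₀≡ = trans p₀ (ℕ.+-identityʳ d)
      p₁≡ = trans p₁ (ℕ.+-identityʳ d)
      leastP = (0F , p₀≡) , λ where
        zero                → ℕ.≤-reflexive (sym p₀≡)
        (suc zero)          → ℕ.≤-reflexive (sym p₁≡)
        (suc (suc zero))    → ℕ.≤-trans (ℕ.m≤m+n d d) (ℕ.≤-reflexive (sym p₂))
        (suc (suc (suc w))) → ℕ.≤-trans (ℕ.m≤m+n d _) (ℕ.≤-reflexive (sym (p₃ w)))
      q₀≡ = trans q₀ (ℕ.+-comm (1 + k) 1)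
      q< = λ where
        zero          → ℕ.<-≤-trans (ℕ.m<m+n d (s≤s z≤n)) (ℕ.≤-reflexive (sym q₁))
        (suc zero)    → ℕ.<-≤-trans (ℕ.m<m+n d (s≤s z≤n)) (ℕ.≤-reflexive (sym q₂))
        (suc (suc w)) → ℕ.<-≤-trans (ℕ.m<m+n d (s≤s z≤n)) (ℕ.≤-reflexive (sym (q₃ w)))
      leastQ = first-leastMisses q q₀≡ q<
      _ , _ , _ , counts = regular d
      minimizers≡ = ℕ.*-cancelʳ-≡ (minimizers p d) (minimizers q d) d (begin
        minimizers p d * d     ≡⟨ neighboursPred-count p leastP ⟨
        neighboursPred p d     ≡⟨ proj₁ (counts p leastP) ⟩
        _                      ≡⟨ proj₁ (counts q leastQ) ⟨
        neighboursPred q d     ≡⟨ neighboursPred-count q leastQ ⟩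
        minimizers q d * d     ∎)
    in 1F≢0F (count≡1⇒unique (λ w → misses p w ℕ.≟ d)
         (trans minimizers≡ (first-unique q q₀≡ q<)) p₀≡ p₁≡)
    where
    open ≡-Reasoning
    1F≢0F : 1F ≢ 0F
    1F≢0F ()
    size-p : (2 + k) + ((2 + k) + 0) ≡ 4 + (k + k)
    size-p = cong (2 +_) (trans (ℕ.+-suc k _) (cong suc
      (trans (ℕ.+-suc k _) (cong (λ x → suc (k + x)) (ℕ.+-identityʳ k)))))
    size-q : (2 + k) + ((1 + k) + 1) ≡ 4 + (k + k)
    size-q = cong (2 +_) (trans (ℕ.+-suc k _) (cong suc (trans (cong (k +_) (ℕ.+-comm k 1)) (ℕ.+-suc k k))))

  -- This is `M = 3 + k`, with `d = M ∸ 1`. The value `1F` makes the difference: it has `d + 1`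
  -- misses in `p`, one too few to be distant, and `d + 2` in `q`. As K is 1 for both, the farther
  -- counts are E times `N ∸ d`, which is `3 + k` and cancels.
  irregular-odd : ∀ k → ¬ Regular (5 + (k + k)) (3 + n)
  irregular-odd k regular =
    let
      d = 2 + k
      p , p₀ , p₁ , p₂ , p₃ = blocks (3 + k) (2 + k) 0 size-p
      q , q₀ , q₁ , q₂ , q₃ = blocks (3 + k) (1 + k) 1 size-q
      p₀≡ = trans p₀ (ℕ.+-identityʳ d)
      p₁≡ = trans p₁ (ℕ.+-identityʳ (suc d))
      q₀≡ = trans q₀ (ℕ.+-comm (1 + k) 1)
      p₂≥ = ℕ.≤-trans (ℕ.m<m+n (suc d) (s≤s z≤n)) (ℕ.≤-reflexive (sym p₂))
      p₃≥ = λ w → ℕ.≤-trans (ℕ.m<m+n (suc d) (s≤s z≤n)) (ℕ.≤-reflexive (sym (p₃ w)))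
      q₁≥ = ℕ.≤-trans (ℕ.m<m+n (suc d) (s≤s z≤n)) (ℕ.≤-reflexive (sym q₁))
      q₂≥ = ℕ.≤-trans (ℕ.m<m+n (suc d) (s≤s z≤n)) (ℕ.≤-reflexive (sym q₂))
      q₃≥ = λ w → ℕ.≤-trans (ℕ.m<m+n (suc d) (s≤s z≤n)) (ℕ.≤-reflexive (sym (q₃ w)))
      p< = λ where
        zero          → ℕ.≤-reflexive (sym p₁≡)
        (suc zero)    → ℕ.<⇒≤ p₂≥
        (suc (suc w)) → ℕ.<⇒≤ (p₃≥ w)
      q< = λ where
        zero          → ℕ.<⇒≤ q₁≥
        (suc zero)    → ℕ.<⇒≤ q₂≥
        (suc (suc w)) → ℕ.<⇒≤ (q₃≥ w)
      leastP = first-leastMisses p p₀≡ p<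
      leastQ = first-leastMisses q q₀≡ q<
      distantP = count-distant p (0F≱ p p₀≡)
        (𝟙-no ((2 + d) ≤? misses p 1F) (λ ≥ → ℕ.<⇒≱ ≥ (ℕ.≤-reflexive p₁≡)))
        (λ where zero → p₂≥ ; (suc w) → p₃≥ w)
      distantQ = count-distant q (0F≱ q q₀≡) (𝟙-yes ((2 + d) ≤? misses q 1F) q₁≥)
        (λ where zero → q₂≥ ; (suc w) → q₃≥ w)
      _ , _ , _ , counts = regular d
      distant≡ = cancel (begin
        1 * (1 * (5 + (k + k) ∸ d)) * distant p d ≡⟨ farther p leastP (first-unique p p₀≡ p<) ⟨
        neighbours p (suc d)                      ≡⟨ proj₂ (proj₂ (counts p leastP)) ⟩
        _                                         ≡⟨ proj₂ (proj₂ (counts q leastQ)) ⟨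
        neighbours q (suc d)                      ≡⟨ farther q leastQ (first-unique q q₀≡ q<) ⟩
        1 * (1 * (5 + (k + k) ∸ d)) * distant q d ∎)
    in ℕ.<⇒≢ (ℕ.n<1+n (suc n)) (trans (sym distantP) (trans distant≡ distantQ))
    where
    open ≡-Reasoning
    N = 5 + (k + k)
    size-p : (3 + k) + ((2 + k) + 0) ≡ N
    size-p = cong (3 +_) (trans (ℕ.+-suc k _) (cong suc
      (trans (ℕ.+-suc k _) (cong (λ x → suc (k + x)) (ℕ.+-identityʳ k)))))
    size-q : (3 + k) + ((1 + k) + 1) ≡ N
    size-q = cong (3 +_) (trans (ℕ.+-suc k _) (cong suc (trans (cong (k +_) (ℕ.+-comm k 1)) (ℕ.+-suc k k))))
    farther : ∀ (p : Vector (Fin (3 + n)) N) {d} → LeastMisses p d → minimizers p d ≡ 1 →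
              neighbours p (suc d) ≡ 1 * (1 * (N ∸ d)) * distant p d
    farther p {d} least ≡1 = trans (neighboursSuc-count p least)
      (cong (λ m → 𝟙 (m ℕ.≟ 1) * (m * (N ∸ d)) * distant p d) ≡1)
    0F≱ : ∀ (p : Vector (Fin (3 + n)) N) {d} → misses p 0F ≡ d → 𝟙 ((2 + d) ≤? misses p 0F) ≡ 0
    0F≱ p {d} ≡d = 𝟙-no ((2 + d) ≤? misses p 0F) (λ ≥ → ℕ.<⇒≱ (ℕ.<⇒≤ ≥) (ℕ.≤-reflexive ≡d))
    count-distant : ∀ (p : Vector (Fin (3 + n)) N) {d x y} → 𝟙 ((2 + d) ≤? misses p 0F) ≡ x →
                    𝟙 ((2 + d) ≤? misses p 1F) ≡ y →
                    (∀ w → 2 + d ≤ misses p (suc (suc w))) → distant p d ≡ x + (y + suc n)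
    count-distant p {d} x≡ y≡ all = cong₂ _+_ x≡ (cong₂ _+_ y≡
      (count-all (λ w → (2 + d) ≤? misses p (suc (suc w))) all))
    cancel : ∀ {x y} → 1 * (1 * (N ∸ (2 + k))) * x ≡ 1 * (1 * (N ∸ (2 + k))) * y → x ≡ y
    cancel {x} {y} eq = ℕ.*-cancelˡ-≡ x y (3 + k) (subst (λ c → c * x ≡ c * y) coefficient eq)
      where
      coefficient : 1 * (1 * (N ∸ (2 + k))) ≡ 3 + k
      coefficient = trans (ℕ.*-identityˡ _) (trans (ℕ.*-identityˡ _) (ℕ.m+n∸n≡m (3 + k) k))

  irregular : ∀ j → ¬ Regular (4 + j) (3 + n)
  irregular j with halve j
  ... | k , inj₁ refl = irregular-even k
  ... | k , inj₂ refl = irregular-odd k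

-- Walks

module _ {v ℓ e} (Γ : SimpleGraph v ℓ e) where
  open SimpleGraph Γ
  private module V = Setoid vertices

  -- `Walk` is built from its start, but profiles are relative to the start, which therefore stays
  -- fixed while the inductions below work at the end.
  snoc : ∀ {k x y z} → Walk Γ k x y → y ~ z → Walk Γ (suc k) x z
  snoc (nil x≈y)    y~z = cons (proj₂ ~-resp-≈ (V.sym x≈y) y~z) (nil V.refl)
  snoc (cons x~u w) y~z = cons x~u (snoc w y~z)

  unsnoc : ∀ {k x z} → Walk Γ (suc k) x z → ∃[ y ] (Walk Γ k x y × y ~ z)
  unsnoc {zero}  (cons x~u (nil u≈z)) = _ , nil V.refl , proj₁ ~-resp-≈ u≈z x~u
  unsnoc {suc k} (cons x~u w) with y , w′ , y~z ← unsnoc w = y , cons x~u w′ , y~z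

-- The diagonal graph

funToFin-cong : ∀ {k l} {f g : Fin k → Fin l} → f ≗ g → funToFin f ≡ funToFin g
funToFin-cong {zero}  _   = refl
funToFin-cong {suc k} f≗g = cong₂ combine (f≗g zero) (funToFin-cong (f≗g ∘ suc))

module _ {c ℓ} (G : Group c ℓ) {n} (cardinality : HasCardinality (Group.setoid G) n) (k : ℕ) where

  private
    module G = Group G
    module el = Inverse cardinality
    open G using (Carrier; _≈_; _∙_; ε; _⁻¹)
    open GroupProperties G using (∙-cancelˡ; ∙-cancelʳ; \\-leftDividesˡ; \\-leftDividesʳ; //-rightDividesˡ)

    m N : ℕ
    m = 2 + k
    N = 3 + k

    Γ : SimpleGraph c ℓ _
    Γ = ΓD G m

    open SimpleGraph Γ using (Vertex; _~_; ~-sym; vertices) renaming (_≈_ to _≋_)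

    el : Fin n → Carrier
    el = el.to

    el-injective : ∀ {a b} → el a ≈ el b → a ≡ b
    el-injective {a} {b} eq = trans (sym (el.strictlyInverseʳ a)) (trans (el.from-cong eq) (el.strictlyInverseʳ b))

    -- Since `N ≥ 3`, two changes always leave a common entry untouched, at which `profile-unique`
    -- can compare the results.
    another : (i j : Fin N) → ∃[ l ] (l ≢ i × l ≢ j)
    another zero          zero          = suc zero       , (λ ()) , (λ ())
    another zero          (suc zero)    = suc (suc zero) , (λ ()) , (λ ())
    another zero          (suc (suc _)) = suc zero       , (λ ()) , (λ ())
    another (suc zero)    zero          = suc (suc zero) , (λ ()) , (λ ())
    another (suc (suc _)) zero          = suc zero       , (λ ()) , (λ ())
    another (suc _)       (suc _)       = zero           , (λ ()) , (λ ())

    hat : Vertex → Vector Carrier N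
    hat x zero    = ε
    hat x (suc i) = x i

    -- The free factor `t` lets every constant profile stand for `x` itself, and lets a move within
    -- a part of `Q₀` become a change of entry 0.
    HasProfile : Vertex → Vertex → Vector (Fin n) N → Set _
    HasProfile x z p = ∃[ t ] (∀ j → hat z j ≈ t ∙ el (p j) ∙ hat x j)

    -- The common form of all the partitions: agreement up to a left factor outside one index. For
    -- an index other than 0, coordinate 0 forces the factor to be `ε`.
    Line : Fin N → Vertex → Vertex → Set _
    Line i y z = ∃[ s ] (∀ j → j ≢ i → hat z j ≈ s ∙ hat y j)

    hat-cong : ∀ {y z} → y ≋ z → ∀ j → hat y j ≈ hat z j
    hat-cong y≋z zero    = G.refl
    hat-cong y≋z (suc j) = y≋z j

    hasProfile-cong : ∀ {x y z p} → y ≋ z → HasProfile x y p → HasProfile x z p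
    hasProfile-cong y≋z (t , eq) = t , λ j → G.trans (G.sym (hat-cong y≋z j)) (eq j)

    samePart⇒line : ∀ {y z} → SamePart G m y z → ∃[ i ] Line i y z
    samePart⇒line (inj₁ (s , eq)) = zero , s , λ where
      zero    ≢ → contradiction refl ≢
      (suc j) _ → eq j
    samePart⇒line (inj₂ (i , eq)) = suc i , ε , λ where
      zero    _ → G.sym (G.identityˡ ε)
      (suc j) ≢ → G.trans (G.sym (eq j (≢ ∘ cong suc))) (G.sym (G.identityˡ _))

    line⇒samePart : ∀ {y z} i → Line i y z → SamePart G m y z
    line⇒samePart zero    (s , eq) = inj₁ (s , λ j → eq (suc j) (λ ()))
    line⇒samePart (suc i) (s , eq) = inj₂ (i , λ j j≢i →
      G.sym (G.trans (eq (suc j) (j≢i ∘ Fin.suc-injective)) (G.trans (G.∙-congʳ s≈ε) (G.identityˡ _))))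
      where
      s≈ε : s ≈ ε
      s≈ε = G.trans (G.sym (G.identityʳ s)) (G.sym (eq zero (λ ())))

    hasProfile-update : ∀ {x y z p i} → HasProfile x y p → Line i y z → ∃[ w ] HasProfile x z (p [ i ≔ w ])
    hasProfile-update {x} {y} {z} {p} {i} (t , eq) (s , line) = w , s ∙ t , at
      where
      open import Relation.Binary.Reasoning.Setoid G.setoid
      -- This is the solution of `hat z i ≈ s ∙ t ∙ g ∙ hat x i`.
      g = (s ∙ t) ⁻¹ ∙ (hat z i ∙ hat x i ⁻¹)
      w = el.from g
      at : ∀ j → hat z j ≈ s ∙ t ∙ el ((p [ i ≔ w ]) j) ∙ hat x j
      at j with j ≟ i
      ... | yes refl = begin
        hat z j                                     ≈⟨ //-rightDividesˡ (hat x j) (hat z j) ⟨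
        hat z j ∙ hat x j ⁻¹ ∙ hat x j              ≈⟨ G.∙-congʳ (\\-leftDividesˡ (s ∙ t) _) ⟨
        s ∙ t ∙ g ∙ hat x j                         ≈⟨ G.∙-congʳ (G.∙-congˡ (el.strictlyInverseˡ g)) ⟨
        s ∙ t ∙ el w ∙ hat x j                      ≡⟨ cong (λ u → s ∙ t ∙ el u ∙ hat x j) (updateAt-updates j p) ⟨
        s ∙ t ∙ el ((p [ i ≔ w ]) j) ∙ hat x j      ∎
      ... | no j≢i = begin
        hat z j                                     ≈⟨ line j j≢i ⟩
        s ∙ hat y j                                 ≈⟨ G.∙-congˡ (eq j) ⟩
        s ∙ (t ∙ el (p j) ∙ hat x j)                ≈⟨ G.assoc s _ _ ⟨
        s ∙ (t ∙ el (p j)) ∙ hat x j                ≈⟨ G.∙-congʳ (G.assoc s t _) ⟨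
        s ∙ t ∙ el (p j) ∙ hat x j
          ≡⟨ cong (λ u → s ∙ t ∙ el u ∙ hat x j) (updateAt-minimal j i p j≢i) ⟨
        s ∙ t ∙ el ((p [ i ≔ w ]) j) ∙ hat x j      ∎

    hasProfile-line : ∀ {x y z p q i} → HasProfile x y p → HasProfile x z q →
                      (∀ j → j ≢ i → p j ≡ q j) → Line i y z
    hasProfile-line {x} {y} {z} {p} {q} {i} (t , eq) (t′ , eq′) agree = t′ ∙ t ⁻¹ , λ j j≢i → begin
      hat z j                                      ≈⟨ eq′ j ⟩
      t′ ∙ el (q j) ∙ hat x j                      ≡⟨ cong (λ u → t′ ∙ el u ∙ hat x j) (agree j j≢i) ⟨
      t′ ∙ el (p j) ∙ hat x j                      ≈⟨ G.assoc t′ _ _ ⟩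
      t′ ∙ (el (p j) ∙ hat x j)                    ≈⟨ G.∙-congˡ (\\-leftDividesʳ t _) ⟨
      t′ ∙ (t ⁻¹ ∙ (t ∙ (el (p j) ∙ hat x j)))     ≈⟨ G.assoc t′ _ _ ⟨
      t′ ∙ t ⁻¹ ∙ (t ∙ (el (p j) ∙ hat x j))       ≈⟨ G.∙-congˡ (G.assoc t _ _) ⟨
      t′ ∙ t ⁻¹ ∙ (t ∙ el (p j) ∙ hat x j)         ≈⟨ G.∙-congˡ (eq j) ⟨
      t′ ∙ t ⁻¹ ∙ hat y j                          ∎
      where open import Relation.Binary.Reasoning.Setoid G.setoid

    -- Agreement at one entry makes the two left factors equal, and these then cancel at every
    -- entry.
    profile-unique : ∀ {x z p q} j → HasProfile x z p → HasProfile x z q → p j ≡ q j → p ≗ q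
    profile-unique {x} {z} {p} {q} j (t , eq) (t′ , eq′) pj≡qj i = el-injective
      (∙-cancelˡ t _ _ (G.trans (same i) (G.∙-congʳ (G.sym t≈t′))))
      where
      same : ∀ i → t ∙ el (p i) ≈ t′ ∙ el (q i)
      same i = ∙-cancelʳ (hat x i) _ _ (G.trans (G.sym (eq i)) (eq′ i))
      t≈t′ : t ≈ t′
      t≈t′ = ∙-cancelʳ (el (p j)) _ _ (G.trans (same j) (G.reflexive (cong (λ u → t′ ∙ el u) (sym pj≡qj))))

    -- Both extended tuples have `ε` at coordinate 0, so equal profiles come with equal left
    -- factors.
    profile-determines : ∀ {x y z p q} → HasProfile x y p → HasProfile x z q → p ≗ q → y ≋ z
    profile-determines {x} {y} {z} {p} {q} (t , eq) (t′ , eq′) p≗q j =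
      G.trans (eq (suc j)) (G.trans (G.∙-congʳ (same (suc j))) (G.sym (eq′ (suc j))))
      where
      t≈t′ : t ≈ t′
      t≈t′ = ∙-cancelʳ (el (p zero)) _ _ (∙-cancelʳ ε _ _ (G.trans (G.sym (eq zero))
        (G.trans (eq′ zero) (G.reflexive (cong (λ u → t′ ∙ el u ∙ ε) (sym (p≗q zero)))))))
      same : ∀ j → t ∙ el (p j) ≈ t′ ∙ el (q j)
      same j = G.∙-cong t≈t′ (G.reflexive (cong el (p≗q j)))

    hasProfile-const : ∀ x w → HasProfile x x (const w)
    hasProfile-const x w = el w ⁻¹ , λ j → G.sym (G.trans (G.∙-congʳ (G.inverseˡ (el w))) (G.identityˡ _))

    -- The left factor is chosen so that coordinate 0 becomes `ε`.
    realize : Vertex → Vector (Fin n) N → Vertex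
    realize x p i = el (p zero) ⁻¹ ∙ el (p (suc i)) ∙ x i

    hasProfile-realize : ∀ x p → HasProfile x (realize x p) p
    hasProfile-realize x p = el (p zero) ⁻¹ , λ where
      zero    → G.sym (G.trans (G.∙-congʳ (G.inverseˡ _)) (G.identityˡ ε))
      (suc j) → G.refl

    profile : Vertex → Vertex → Vector (Fin n) N
    profile x z j = el.from (hat z j ∙ hat x j ⁻¹)

    hasProfile-profile : ∀ x z → HasProfile x z (profile x z)
    hasProfile-profile x z = ε , λ j → G.sym (G.trans
      (G.∙-congʳ (G.trans (G.identityˡ _) (el.strictlyInverseˡ _))) (//-rightDividesˡ (hat x j) (hat z j)))

    adjacent⇒update : ∀ {x y z p} → HasProfile x y p → y ~ z →
                      ∃₂ λ i w → p i ≢ w × HasProfile x z (p [ i ≔ w ])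
    adjacent⇒update {x} {p = p} hp (y≉z , part)
      with i , line ← samePart⇒line part
      with w , hq ← hasProfile-update {p = p} hp line
      = i , w , (λ pi≡w → y≉z (profile-determines {x} {p = p} hp hq (unchanged i pi≡w))) , hq
      where
      unchanged : ∀ i {w} → p i ≡ w → p ≗ p [ i ≔ w ]
      unchanged i refl j with j ≟ i
      ... | yes refl = sym (updateAt-updates j p)
      ... | no j≢i   = sym (updateAt-minimal j i p j≢i)

    update⇒adjacent : ∀ {x y z p i w} → HasProfile x y p → p i ≢ w → HasProfile x z (p [ i ≔ w ]) → y ~ z
    update⇒adjacent {x} {y} {z} {p} {i} {w} hp pi≢w hq =
        -- If `y` and `z` were equal, both profiles would belong to one vertex and agree at `l`,
        -- hence also at `i`.
        (λ y≋z → pi≢w (trans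
          (profile-unique l (hasProfile-cong {x} {p = p} y≋z hp) hq (agree l l≢i) i) (updateAt-updates i p)))
      , line⇒samePart i (hasProfile-line {x} {p = p} hp hq agree)
      where
      agree : ∀ j → j ≢ i → p j ≡ (p [ i ≔ w ]) j
      agree j j≢i = sym (updateAt-minimal j i p j≢i)
      l = proj₁ (another i i)
      l≢i = proj₁ (proj₂ (another i i))

    -- A walk of length 0 leaves the profile constant. Undoing the last step of a longer walk
    -- changes one entry, which lowers the misses of any value by at most one.
    walk⇒misses : ∀ {d x z p} → Walk Γ d x z → HasProfile x z p → ∃[ w ] misses p w ≤ d
    walk⇒misses {zero} {x} {z} {p} (nil x≋z) hp = p zero ,
      ℕ.≤-reflexive (count-none (λ j → ¬? (p j ≟ p zero)) (λ j ≢ → ≢ (constant j)))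
      where
      constant : p ≗ const (p zero)
      constant = profile-unique {x} zero hp (hasProfile-cong {x} {p = const (p zero)} x≋z (hasProfile-const x (p zero))) refl
    walk⇒misses {suc d} {x} {z} {p} walk hp =
      let y , walk′ , y~z        = unsnoc Γ walk
          i , w , pi≢w , hq      = adjacent⇒update {x} {z} {y} {p} hp (~-sym y~z)
          v , misses≤            = walk⇒misses {p = p [ i ≔ w ]} walk′ hq
      in v , ℕ.≤-trans (misses-update-suc p v pi≢w) (s≤s misses≤)

    -- Entries different from `w` are replaced by `w` one at a time, until the profile is constant
    -- and the vertex is `x`.
    misses⇒walk : ∀ d {x z p w} → HasProfile x z p → misses p w ≡ d → Walk Γ d x z
    misses⇒walk zero {x} {p = p} {w} hp ≡0 =
      nil (profile-determines {x} {p = const w} (hasProfile-const x w) hp λ j → sym (constant j))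
      where
      constant : ∀ j → p j ≡ w
      constant j with p j ≟ w
      ... | yes pj≡w = pj≡w
      ... | no  pj≢w = contradiction ≡0 (count-positive (λ j → ¬? (p j ≟ w)) pj≢w)
    misses⇒walk (suc d) {x} {z} {p} {w} hp ≡1+d =
      let i , pi≢w = count-any (λ j → ¬? (p j ≟ w)) (λ ≡0 → ℕ.1+n≢0 (trans (sym ≡1+d) ≡0))
          q        = p [ i ≔ w ]
          hq       = hasProfile-realize x q
          walk     = misses⇒walk d {x} {p = q} {w} hq (ℕ.suc-injective (trans (misses-update-new p pi≢w) ≡1+d))
      in snoc Γ walk (~-sym (update⇒adjacent {x} {z} {realize x q} {p} hp pi≢w hq))

    leastMisses⇒atDistance : ∀ {d x z p} → HasProfile x z p → LeastMisses p d → AtDistance Γ d x z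
    leastMisses⇒atDistance {d} {x} {z} {p} hp ((w , ≡d) , d≤) = misses⇒walk d {p = p} hp ≡d , λ l walk →
      let v , misses≤ = walk⇒misses {p = p} walk hp in ℕ.≤-trans (d≤ v) misses≤

    -- The misses of any value are the length of some walk, hence at least `d`; a walk of length `d`
    -- provides a value that attains the bound.
    atDistance⇒leastMisses : ∀ {d x z p} → HasProfile x z p → AtDistance Γ d x z → LeastMisses p d
    atDistance⇒leastMisses {d} {x} {z} {p} hp (walk , shortest) =
      let w , misses≤ = walk⇒misses {p = p} walk hp in (w , ℕ.≤-antisym misses≤ (d≤ w)) , d≤
      where
      d≤ : ∀ v → d ≤ misses p v
      d≤ v = shortest _ (misses⇒walk (misses p v) {p = p} hp refl)

    -- Numbers of neighbours in the graph.

    module _ {x y p} (hp : HasProfile x y p) where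

      number-of-neighbours : ∀ d → NumberOf Γ (NeighbourAtDistance Γ d x y) (neighbours p d)
      number-of-neighbours d = subst (NumberOf Γ (NeighbourAtDistance Γ d x y)) count≡
        (parametrized-cardinality vertices at? (λ j → neighbour (pair j)) sound injective complete)
        where
        pair : Fin (N * n) → Fin N × Fin n
        pair = remQuot n
        At : Fin (N * n) → Set
        At j = uncurry (Neighbour p d) (pair j)
        at? : Decidable At
        at? j = neighbour? p d (proj₁ (pair j)) (proj₂ (pair j))
        update : Fin N × Fin n → Vector (Fin n) N
        update (i , w) = p [ i ≔ w ]
        neighbour : Fin N × Fin n → Vertex
        neighbour iw = realize x (update iw)

        count≡ : count at? ≡ neighbours p d
        count≡ = trans (sum-combine N n (𝟙 ∘ at?)) (sum-cong-≗ λ i → sum-cong-≗ λ w →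
          cong (λ (i , w) → 𝟙 (neighbour? p d i w)) (Fin.remQuot-combine i w))

        sound : ∀ {j} → At j → NeighbourAtDistance Γ d x y (neighbour (pair j))
        sound {j} (pi≢w , least) =
            update⇒adjacent {x} {y} {neighbour (pair j)} {p} hp pi≢w (hasProfile-realize x (update (pair j)))
          , leastMisses⇒atDistance {p = update (pair j)} (hasProfile-realize x (update (pair j))) least

        -- At `i` the first change departs from `p`, so the second must have changed the same entry.
        update-injective : ∀ iw iw′ → p (proj₁ iw) ≢ proj₂ iw → update iw ≗ update iw′ → iw ≡ iw′
        update-injective (i , w) (i′ , w′) pi≢w eq with i ≟ i′
        ... | yes refl = cong (i ,_) (trans (sym (updateAt-updates i p)) (trans (eq i) (updateAt-updates i p)))
        ... | no i≢i′  = contradiction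
          (sym (trans (sym (updateAt-updates i p)) (trans (eq i) (updateAt-minimal i i′ p i≢i′)))) pi≢w

        injective : ∀ {j j′} → At j → At j′ → neighbour (pair j) ≋ neighbour (pair j′) → j ≡ j′
        injective {j} {j′} (pi≢w , _) _ eq =
          -- Both updated profiles describe the same vertex and keep the entry of `p` at `l`, so
          -- they coincide.
          let l , l≢i , l≢i′ = another (proj₁ (pair j)) (proj₁ (pair j′))
              agree = trans (updateAt-minimal l _ p l≢i) (sym (updateAt-minimal l _ p l≢i′))
              same  = profile-unique {x} l
                        (hasProfile-cong {x} {p = update (pair j)} eq (hasProfile-realize x (update (pair j))))
                        (hasProfile-realize x (update (pair j′))) agree
          in trans (sym (Fin.combine-remQuot {N} n j))
               (trans (cong (uncurry combine) (update-injective (pair j) (pair j′) pi≢w same))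
                 (Fin.combine-remQuot {N} n j′))

        complete : ∀ {z} → NeighbourAtDistance Γ d x y z → ∃[ j ] (At j × neighbour (pair j) ≋ z)
        complete {z} (y~z , distance) =
          let i , w , pi≢w , hq = adjacent⇒update {x} {y} {z} {p} hp y~z
          in combine i w
           , subst (uncurry (Neighbour p d)) (sym (Fin.remQuot-combine i w))
               (pi≢w , atDistance⇒leastMisses {p = p [ i ≔ w ]} hq distance)
           , subst (λ iw → neighbour iw ≋ z) (sym (Fin.remQuot-combine i w))
               (profile-determines {x} {p = p [ i ≔ w ]} (hasProfile-realize x (p [ i ≔ w ])) hq (λ _ → refl))

      number-of-pred-neighbours : ∀ d → NumberOf Γ (NeighbourAtPredDistance Γ d x y) (neighboursPred p d)
      number-of-pred-neighbours zero = mkCardinality (subsetoid vertices (NeighbourAtPredDistance Γ 0 x y))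
        (λ ()) (λ { (_ , _ , () , _) }) (λ { {_ , _ , () , _} }) (λ { (_ , _ , () , _) }) (λ ())
      number-of-pred-neighbours (suc d) = subset-cardinality-cong vertices
        (λ at → d , refl , at) (λ { (_ , refl , at) → at }) (number-of-neighbours d)

    finite : Finite vertices
    finite = n ^ m , mkCardinality vertices
      (λ i j → el (finToFun i j)) (λ f → funToFin (el.from ∘ f))
      (λ f≋g → funToFin-cong (λ j → el.from-cong (f≋g j)))
      (λ f j → G.trans (G.reflexive (cong el (Fin.finToFun-funToFin (el.from ∘ f) j))) (el.strictlyInverseˡ (f j)))
      (λ i → trans (funToFin-cong {m} {g = finToFun i} (λ j → el.strictlyInverseʳ (finToFun i j)))
        (Fin.funToFin-finToFin {m} {n} i))

    connected : Connected Γ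
    connected x z = misses p (p zero) , misses⇒walk _ {p = p} (hasProfile-profile x z) refl
      where p = profile x z

  -- Every pair of vertices has a profile, and every profile is realised from one base vertex, so
  -- quantifying over pairs and over profiles amounts to the same. Cardinalities being unique, the
  -- parameters carry over.
  distanceRegular⇔regular : DistanceRegular (ΓD G (2 + k)) ⇔ Regular (3 + k) n
  distanceRegular⇔regular = mk⇔ to from
    where
    to : DistanceRegular Γ → Regular N n
    to (_ , _ , counts) d with c , a , b , counts-d ← counts d = c , a , b , λ p least →
      let x          = const ε
          y          = realize x p
          hp         = hasProfile-realize x p
          c# , a# , b# = counts-d x y (leastMisses⇒atDistance {p = p} hp least)
      in cardinality-unique (subsetoid vertices (NeighbourAtPredDistance Γ d x y))
           (number-of-pred-neighbours {p = p} hp d) c#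
       , cardinality-unique (subsetoid vertices (NeighbourAtDistance Γ d x y)) (number-of-neighbours {p = p} hp d) a#
       , cardinality-unique (subsetoid vertices (NeighbourAtDistance Γ (suc d) x y))
           (number-of-neighbours {p = p} hp (suc d)) b#

    from : Regular N n → DistanceRegular Γ
    from regular = finite , connected , λ d → let c , a , b , counts = regular d in c , a , b , λ x y distance →
      let p  = profile x y
          hp = hasProfile-profile x y
          c≡ , a≡ , b≡ = counts p (atDistance⇒leastMisses {p = p} hp distance)
      in subst (NumberOf Γ (NeighbourAtPredDistance Γ d x y)) c≡ (number-of-pred-neighbours {p = p} hp d)
       , subst (NumberOf Γ (NeighbourAtDistance Γ d x y)) a≡ (number-of-neighbours {p = p} hp d)
       , subst (NumberOf Γ (NeighbourAtDistance Γ (suc d) x y)) b≡ (number-of-neighbours {p = p} hp (suc d))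

proposition7p3 : ∀ {c ℓ} (m : ℕ) → 2 ≤ m →
    (G : Group c ℓ) (n : ℕ) → HasCardinality (Group.setoid G) n → 2 ≤ n →
    DistanceRegular (ΓD G m) ⇔ (m ≡ 2 ⊎ n ≡ 2)
proposition7p3 (suc (suc k)) (s≤s (s≤s z≤n)) G n cardinality 2≤n =
  mk⇔ (necessary k 2≤n ∘ E.to) (E.from ∘ sufficient)
  where
  module E = Equivalence (distanceRegular⇔regular G cardinality k)
  necessary : ∀ {n} k → 2 ≤ n → Regular (3 + k) n → 2 + k ≡ 2 ⊎ n ≡ 2
  necessary zero    _                     _       = inj₁ refl
  -- For `m ≥ 3` the bound on `n` leaves `n = 2` or `n ≥ 3`; the latter is excluded by the two pairs
  -- of profiles above.
  necessary (suc j) (s≤s (s≤s (z≤n {zero})))      _       = inj₂ refl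
  necessary (suc j) (s≤s (s≤s (z≤n {suc _})))     regular = contradiction regular (irregular j)
  sufficient : 2 + k ≡ 2 ⊎ n ≡ 2 → Regular (3 + k) n
  sufficient (inj₁ refl) = regular-length-three n
  sufficient (inj₂ refl) = regular-two-values (3 + k)
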